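{- Let $L$ be a finite distributive lattice and let $K$ be a cutting of $L$. For every $k\ge0$, $$q_k(L\boxplus K)=q_k(L)+q_k(K)+q_{k-1}(K).$$ In particular, $|L\boxplus K|=|L|+|K|$.
   Context: For a finite poset $P$, $\mathcal{F}(P)$ is the set of filters (up-sets) of $P$ ordered by reverse inclusion; every finite distributive lattice is isomorphic to some $\mathcal{F}(P)$. A cutting of a finite distributive lattice $L$ is an interval $K=[\hat0_K,\hat1_K]$ of $L$ such that every maximal chain of $L$ meets $K$. For a cutting $K$ of $L=\mathcal{F}(P)$, let $S=\hat0_K\setminus\hat1_K$, $S_0$ the set of maximal elements of $P\setminus\hat0_K$, $S_1$ the set of minimal elements of $\hat1_K$. The poset $P_K$ is $P\cup\{x_K\}$ ($x_K$ new) where the order on $P$ is unchanged, $z<x_K$ iff $z\le s$ for some $s\in S_0$, $x_K<y$ iff $y\ge s$ for some $s\in S_1$, and $x_K$ is incomparable to every element of $S$. The convex expansion is $L\boxplus K:=\mathcal{F}(P_K)$. For a finite lattice $M$ and $k\ge0$, $q_k(M)$ is the number of convex sublattices (intervals) of $M$ isomorphic to the Boolean lattice $\mathbf{B}_k$ with $2^k$ elements (so $q_0(M)=|M|$), and $q_{ -1}(M)=0$. -}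

module Defs where

open import Data.Bool.Base using (Bool; T)
open import Data.Bool.Properties using (T?)
open import Data.Empty using (⊥-elim)
open import Data.Fin.Base using (Fin; zero; suc; finToFun; funToFin)
import Data.Fin.Properties as Fin
import Data.Fin.Subset as FS
import Data.Fin.Subset.Properties as FSₚ
open import Data.Integer.Base using (ℤ; +_; -[1+_])
open import Data.List.Base as List using (List; []; _∷_; _++_; map; length; filter; cartesianProduct)
import Data.List.Membership.Setoid as Membership
import Data.List.Membership.Setoid.Properties as Membershipₚ
open import Data.List.Relation.Unary.All as All using (All; []; _∷_)
open import Data.List.Relation.Unary.AllPairs using ([]; _∷_)
open import Data.List.Relation.Unary.Any as Any using (here; there)
import Data.List.Relation.Unary.Any.Properties as Anyₚ
open import Data.List.Relation.Unary.Enumerates.Setoid using (IsEnumeration)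
open import Data.List.Relation.Unary.Unique.Setoid using (Unique)
import Data.List.Relation.Unary.Unique.Setoid.Properties as Uniqueₚ
open import Data.Maybe.Base using (Maybe; just; nothing)
open import Data.Maybe.Relation.Binary.Pointwise as Pointwise using (Pointwise; just; nothing)
open import Data.Nat.Base using (ℕ; zero; suc)
open import Data.Product.Base using (Σ; ∃-syntax; _×_; _,_; proj₁; proj₂)
open import Data.Sum.Base as Sum using (_⊎_; inj₁; inj₂; [_,_]′)
open import Data.Vec.Base as Vec using ([]; _∷_)
import Data.Vec.Properties as Vecₚ
open import Function.Base using (_∘_; id)
open import Level using (Level; _⊔_) renaming (suc to lsuc)
open import Relation.Binary.Bundles using (Setoid; Poset)
open import Relation.Binary.Core using (Rel)
open import Relation.Binary.Lattice.Bundles using (DistributiveLattice)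
import Relation.Binary.Construct.On as On
open import Relation.Binary.Morphism.Structures using (IsOrderIsomorphism)
open import Relation.Binary.PropositionalEquality as ≡ using (_≡_; refl)
open import Relation.Nullary.Decidable as Dec using (Dec; yes; no; ¬?; _×-dec_; _⊎-dec_; _→-dec_; toWitness; fromWitness)
open import Relation.Nullary.Negation using (¬_; contradiction)
open import Relation.Unary using (Pred; Decidable)

private
  variable
    a c c′ ℓ ℓ₁ ℓ₁′ ℓ₂ ℓ₂′ p : Level

-- A finite poset comes with a repetition-free list of its elements and a
-- decidable order; classically the order of a finite poset is always
-- decidable.
record IsFinite (P : Poset c ℓ₁ ℓ₂) : Set (c ⊔ ℓ₁ ⊔ ℓ₂) where
  open Poset P using (Carrier; _≤_; module Eq)
  infix 4 _≤?_
  field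
    elements : List Carrier
    complete : IsEnumeration Eq.setoid elements
    unique   : Unique Eq.setoid elements
    _≤?_     : ∀ x y → Dec (x ≤ y)

record FinPoset c ℓ₁ ℓ₂ : Set (lsuc (c ⊔ ℓ₁ ⊔ ℓ₂)) where
  field
    poset    : Poset c ℓ₁ ℓ₂
    isFinite : IsFinite poset
  open Poset poset public using (Carrier; _≈_; _≤_; isPartialOrder; antisym; reflexive; module Eq)
    renaming (refl to ≤-refl; trans to ≤-trans)
  open IsFinite isFinite public

  card : ℕ
  card = length elements

record FinDistributiveLattice c ℓ₁ ℓ₂ : Set (lsuc (c ⊔ ℓ₁ ⊔ ℓ₂)) where
  field
    distributiveLattice : DistributiveLattice c ℓ₁ ℓ₂
    isFinite            : IsFinite (DistributiveLattice.poset distributiveLattice)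

  finPoset : FinPoset c ℓ₁ ℓ₂
  finPoset = record { isFinite = isFinite }

  open FinPoset finPoset public using (Carrier; _≤_)

open FinPoset using (card) public

infix 4 _≅_

record _≅_ (M : FinPoset c ℓ₁ ℓ₂) (N : FinPoset c′ ℓ₁′ ℓ₂′) :
           Set (c ⊔ ℓ₁ ⊔ ℓ₂ ⊔ c′ ⊔ ℓ₁′ ⊔ ℓ₂′) where
  private
    module M = FinPoset M
    module N = FinPoset N
  field
    to                 : M.Carrier → N.Carrier
    isOrderIsomorphism : IsOrderIsomorphism M._≈_ N._≈_ M._≤_ N._≤_ to
  open IsOrderIsomorphism isOrderIsomorphism public

lookup-injective : (S : Setoid a ℓ) → ∀ {xs} → Unique S xs → ∀ i j →
                   Setoid._≈_ S (List.lookup xs i) (List.lookup xs j) → i ≡ j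
lookup-injective S (_ ∷ _)   zero    zero    _  = refl
lookup-injective S (x ∷ _)   zero    (suc j) eq =
  contradiction eq (All.lookupₛ S (λ y≈z x≉y x≈z → x≉y (Setoid.trans S x≈z (Setoid.sym S y≈z))) x
                     (Membershipₚ.∈-lookup S _ j))
lookup-injective S (x ∷ _)   (suc i) zero    eq =
  contradiction (Setoid.sym S eq)
    (All.lookupₛ S (λ y≈z x≉y x≈z → x≉y (Setoid.trans S x≈z (Setoid.sym S y≈z))) x
                     (Membershipₚ.∈-lookup S _ i))
lookup-injective S (_ ∷ xs!) (suc i) (suc j) eq = ≡.cong suc (lookup-injective S xs! i j eq)

module Search (M : FinPoset c ℓ₁ ℓ₂) where
  open FinPoset M hiding (card)

  at : Fin (card M) → Carrier
  at = List.lookup elements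

  index : Carrier → Fin (card M)
  index x = Any.index (complete x)

  at-index : ∀ x → x ≈ at (index x)
  at-index x = Anyₚ.lookup-index (complete x)

  at-injective : ∀ {i j} → at i ≈ at j → i ≡ j
  at-injective = lookup-injective Eq.setoid unique _ _

  index-at : ∀ i → index (at i) ≡ i
  index-at i = at-injective (Eq.sym (at-index (at i)))

  index-cong : ∀ {x y} → x ≈ y → index x ≡ index y
  index-cong x≈y =
    at-injective (Eq.trans (Eq.sym (at-index _)) (Eq.trans x≈y (at-index _)))

  ≤-resp : ∀ {x x′ y y′} → x ≈ x′ → y ≈ y′ → x ≤ y → x′ ≤ y′
  ≤-resp x≈x′ y≈y′ x≤y = ≤-trans (reflexive (Eq.sym x≈x′)) (≤-trans x≤y (reflexive y≈y′))

  infix 4 _≈?_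
  _≈?_ : ∀ x y → Dec (x ≈ y)
  x ≈? y = Dec.map′ (λ (x≤y , y≤x) → antisym x≤y y≤x)
                    (λ x≈y → reflexive x≈y , reflexive (Eq.sym x≈y))
                    (x ≤? y ×-dec y ≤? x)

  module _ {Q : Pred Carrier p} (resp : ∀ {x y} → x ≈ y → Q x → Q y) (Q? : Decidable Q) where

    any? : Dec (∃[ x ] Q x)
    any? = Dec.map′ (λ (i , q) → at i , q) (λ (x , q) → index x , resp (at-index x) q)
                    (Fin.any? (Q? ∘ at))

    all? : Dec (∀ x → Q x)
    all? = Dec.map′ (λ q x → resp (Eq.sym (at-index x)) (q (index x))) (_∘ at)
                    (Fin.all? (Q? ∘ at))

module _ (M : FinPoset c ℓ₁ ℓ₂) (N : FinPoset c′ ℓ₁′ ℓ₂′) where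
  private
    module M where
      open FinPoset M public hiding (card)
      open Search M public
    module N where
      open FinPoset N public hiding (card)
      open Search N public

    IndexIso : (Fin (card M) → Fin (card N)) → Set _
    IndexIso g =
      (∀ i j → (M.at i M.≤ M.at j → N.at (g i) N.≤ N.at (g j))
             × (N.at (g i) N.≤ N.at (g j) → M.at i M.≤ M.at j))
      × (∀ k → ∃[ i ] g i ≡ k)

    indexIso? : Decidable IndexIso
    indexIso? g =
      (Fin.all? λ i → Fin.all? λ j →
         let d = M.at i M.≤? M.at j
             e = N.at (g i) N.≤? N.at (g j)
         in (d →-dec e) ×-dec (e →-dec d))
      ×-dec (Fin.all? λ k → Fin.any? λ i → g i Fin.≟ k)

    fromIndexIso : ∀ g → IndexIso g → M ≅ N
    fromIndexIso g (ord , sur) = record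
      { to = f
      ; isOrderIsomorphism = record
        { isOrderMonomorphism = record
          { isOrderHomomorphism = record
            { cong = λ x≈y → N.Eq.reflexive (≡.cong (N.at ∘ g) (M.index-cong x≈y))
            ; mono = λ x≤y → proj₁ (ord _ _) (M.≤-resp (M.at-index _) (M.at-index _) x≤y)
            }
          ; injective = λ fx≈fy → M.antisym (cancel (N.reflexive fx≈fy))
                                            (cancel (N.reflexive (N.Eq.sym fx≈fy)))
          ; cancel = cancel
          }
        ; surjective = λ y → M.at (proj₁ (sur (N.index y))) , λ {z} z≈ →
            N.Eq.trans
              (N.Eq.reflexive (≡.cong N.at (≡.trans
                (≡.cong g (≡.trans (M.index-cong z≈) (M.index-at _)))
                (proj₂ (sur (N.index y))))))
              (N.Eq.sym (N.at-index y))
        }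
      }
      where
      f : M.Carrier → N.Carrier
      f x = N.at (g (M.index x))

      cancel : ∀ {x y} → f x N.≤ f y → x M.≤ y
      cancel fx≤fy = M.≤-resp (M.Eq.sym (M.at-index _)) (M.Eq.sym (M.at-index _))
                              (proj₂ (ord _ _) fx≤fy)

    toIndexIso : (φ : M ≅ N) → IndexIso (λ i → N.index (_≅_.to φ (M.at i)))
    toIndexIso φ =
      (λ i j → (λ le → N.≤-resp (N.at-index _) (N.at-index _) (φ.mono le))
             , (λ le → φ.cancel (N.≤-resp (N.Eq.sym (N.at-index _)) (N.Eq.sym (N.at-index _)) le)))
      , λ k → let (x , eq) = φ.surjective (N.at k) in
          M.index x , ≡.trans (N.index-cong (eq (M.Eq.sym (M.at-index x)))) (N.index-at k)
      where module φ = _≅_ φ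

    indexIso-resp : ∀ {g h} → (∀ i → g i ≡ h i) → IndexIso g → IndexIso h
    indexIso-resp g≗h (ord , sur) =
      (λ i j → ≡.subst₂ (λ u v → (M.at i M.≤ M.at j → N.at u N.≤ N.at v)
                               × (N.at u N.≤ N.at v → M.at i M.≤ M.at j))
                        (g≗h i) (g≗h j) (ord i j))
      , λ k → proj₁ (sur k) , ≡.trans (≡.sym (g≗h _)) (proj₂ (sur k))

  infix 4 _≅?_
  _≅?_ : Dec (M ≅ N)
  _≅?_ = Dec.map′
    (λ (i , iso) → fromIndexIso (finToFun i) iso)
    (λ φ → let g = λ i → N.index (_≅_.to φ (M.at i)) in
       funToFin g , indexIso-resp (λ i → ≡.sym (Fin.finToFun-funToFin g i)) (toIndexIso φ))
    (Fin.any? (indexIso? ∘ finToFun))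

module _ (M : FinPoset c ℓ₁ ℓ₂) (Q : Pred (FinPoset.Carrier M) p)
         (resp : ∀ {x y} → FinPoset._≈_ M x y → Q x → Q y) (Q? : Decidable Q) where
  open FinPoset M hiding (card)

  private
    sub : Poset _ _ _
    sub = record
      { Carrier = Σ Carrier Q
      ; isPartialOrder = On.isPartialOrder proj₁ isPartialOrder
      }
    S = Poset.Eq.setoid sub

    open Membership Eq.setoid using (_∈_)
    open Membership S using () renaming (_∈_ to _∈ₛ_)

    select : List Carrier → List (Σ Carrier Q)
    select []       = []
    select (x ∷ xs) with Q? x
    ... | yes qx = (x , qx) ∷ select xs
    ... | no  _  = select xs

    select⁺ : ∀ {x} (qx : Q x) {xs} → x ∈ xs → (x , qx) ∈ₛ select xs
    select⁺ qx {y ∷ xs} x∈ with Q? y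
    select⁺ qx (here x≈y)   | yes _  = here x≈y
    select⁺ qx (there x∈)   | yes _  = there (select⁺ qx x∈)
    select⁺ qx (here x≈y)   | no ¬qy = contradiction (resp x≈y qx) ¬qy
    select⁺ qx (there x∈)   | no _   = select⁺ qx x∈

    select-All : ∀ {ℓ} {R : Pred Carrier ℓ} {xs} → All R xs → All (R ∘ proj₁) (select xs)
    select-All []       = []
    select-All {xs = x ∷ _} (r ∷ rs) with Q? x
    ... | yes _ = r ∷ select-All rs
    ... | no  _ = select-All rs

    select! : ∀ {xs} → Unique Eq.setoid xs → Unique S (select xs)
    select! []                   = []
    select! {xs = x ∷ _} (x∉ ∷ xs!) with Q? x
    ... | yes _ = select-All x∉ ∷ select! xs!
    ... | no  _ = select! xs!

  induced : FinPoset (c ⊔ p) ℓ₁ ℓ₂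
  induced = record
    { poset    = sub
    ; isFinite = record
      { elements = select elements
      ; complete = λ (x , qx) → select⁺ qx (complete x)
      ; unique   = select! unique
      ; _≤?_     = λ x y → proj₁ x ≤? proj₁ y
      }
    }

interval : (M : FinPoset c ℓ₁ ℓ₂) (a b : FinPoset.Carrier M) → FinPoset (c ⊔ ℓ₂) ℓ₁ ℓ₂
interval M a b = induced M (λ x → a ≤ x × x ≤ b)
  (λ x≈y (a≤x , x≤b) → ≤-trans a≤x (reflexive x≈y) , ≤-trans (reflexive (Eq.sym x≈y)) x≤b)
  (λ x → a ≤? x ×-dec x ≤? b)
  where open FinPoset M

allSubsets : ∀ n → List (FS.Subset n)
allSubsets zero    = [] ∷ []
allSubsets (suc n) = map (FS.inside ∷_) (allSubsets n) ++ map (FS.outside ∷_) (allSubsets n)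

allSubsets-complete : ∀ n → IsEnumeration (≡.setoid (FS.Subset n)) (allSubsets n)
allSubsets-complete zero    []               = here refl
allSubsets-complete (suc n) (FS.inside ∷ S)  = Membershipₚ.∈-++⁺ˡ (≡.setoid _)
  (Membershipₚ.∈-map⁺ (≡.setoid _) (≡.setoid _) (≡.cong (FS.inside ∷_)) (allSubsets-complete n S))
allSubsets-complete (suc n) (FS.outside ∷ S) = Membershipₚ.∈-++⁺ʳ (≡.setoid _) _
  (Membershipₚ.∈-map⁺ (≡.setoid _) (≡.setoid _) (≡.cong (FS.outside ∷_)) (allSubsets-complete n S))

allSubsets-unique : ∀ n → Unique (≡.setoid (FS.Subset n)) (allSubsets n)
allSubsets-unique zero    = [] ∷ []
allSubsets-unique (suc n) = Uniqueₚ.++⁺ (≡.setoid _)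
  (Uniqueₚ.map⁺ (≡.setoid _) (≡.setoid _) Vecₚ.∷-injectiveʳ (allSubsets-unique n))
  (Uniqueₚ.map⁺ (≡.setoid _) (≡.setoid _) Vecₚ.∷-injectiveʳ (allSubsets-unique n))
  λ (v∈ , v∈′) →
    let (_ , _ , eq)  = Membershipₚ.∈-map⁻ (≡.setoid _) (≡.setoid _) v∈
        (_ , _ , eq′) = Membershipₚ.∈-map⁻ (≡.setoid _) (≡.setoid _) v∈′
    in contradiction (Vecₚ.∷-injectiveˡ (≡.trans (≡.sym eq) eq′)) λ ()

𝐁 : ℕ → FinPoset _ _ _
𝐁 k = record
  { poset    = FSₚ.⊆-poset k
  ; isFinite = record
    { elements = allSubsets k
    ; complete = allSubsets-complete k
    ; unique   = allSubsets-unique k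
    ; _≤?_     = FSₚ._⊆?_
    }
  }

-- The nonempty convex sublattices of a finite lattice are the intervals
-- [a , b] with a ≤ b, each given by exactly one such pair.
IsBooleanInterval : (M : FinPoset c ℓ₁ ℓ₂) → ℕ → Pred (FinPoset.Carrier M × FinPoset.Carrier M) _
IsBooleanInterval M k (a , b) = FinPoset._≤_ M a b × interval M a b ≅ 𝐁 k

isBooleanInterval? : (M : FinPoset c ℓ₁ ℓ₂) (k : ℕ) → Decidable (IsBooleanInterval M k)
isBooleanInterval? M k (a , b) = FinPoset._≤?_ M a b ×-dec (interval M a b ≅? 𝐁 k)

q : ℤ → FinPoset c ℓ₁ ℓ₂ → ℕ
q (+ k)    M = length (filter (isBooleanInterval? M k) (cartesianProduct elements elements))
  where open FinPoset M
q -[1+ _ ] M = 0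

record Subset (M : FinPoset c ℓ₁ ℓ₂) : Set (c ⊔ ℓ₁) where
  open FinPoset M using (Carrier; _≈_)
  field
    contains : Carrier → Bool
    resp     : ∀ {x y} → x ≈ y → T (contains x) → T (contains y)

module _ {M : FinPoset c ℓ₁ ℓ₂} where
  open FinPoset M hiding (card)

  infix 4 _∈_ _∉_ _⊆_

  _∈_ _∉_ : Carrier → Subset M → Set
  x ∈ U = T (Subset.contains U x)
  x ∉ U = ¬ x ∈ U

  _⊆_ : Rel (Subset M) _
  U ⊆ V = ∀ {x} → x ∈ U → x ∈ V

  ⟪_⟫ : {Q : Pred Carrier p} → Decidable Q → (∀ {x y} → x ≈ y → Q x → Q y) → Subset M
  ⟪ Q? ⟫ resp = record
    { contains = λ x → Dec.isYes (Q? x)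
    ; resp     = λ {x} {y} x≈y x∈ → fromWitness {a? = Q? y} (resp x≈y (toWitness {a? = Q? x} x∈))
    }

  IsUpClosed : Pred (Subset M) _
  IsUpClosed U = ∀ x y → x ≤ y → x ∈ U → y ∈ U

  IsChain : Pred (Subset M) _
  IsChain C = ∀ {x y} → x ∈ C → y ∈ C → x ≤ y ⊎ y ≤ x

  IsMaximalChain : Pred (Subset M) _
  IsMaximalChain C = IsChain C × (∀ D → IsChain D → C ⊆ D → D ⊆ C)

reverseInclusion : (M : FinPoset c ℓ₁ ℓ₂) → FinPoset (c ⊔ ℓ₁) c c
reverseInclusion M = record
  { poset = record
    { Carrier = Subset M
    ; _≈_ = λ U V → V ⊆ U × U ⊆ V
    ; _≤_ = λ U V → V ⊆ U
    ; isPartialOrder = record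
      { isPreorder = record
        { isEquivalence = record
          { refl  = id , id
          ; sym   = λ (f , g) → g , f
          ; trans = λ (f , g) (h , k) → (λ z → f (h z)) , (λ z → k (g z))
          }
        ; reflexive = proj₁
        ; trans = λ f g z → f (g z)
        }
      ; antisym = _,_
      }
    }
  ; isFinite = record
    { elements = map decode (allSubsets n)
    ; complete = λ U → Membershipₚ.∈-resp-≈ setoid {_} {decode (encode U)} {U} (decode-encode U)
        (Membershipₚ.∈-map⁺ (≡.setoid _) setoid (λ { refl → id , id })
          (allSubsets-complete n (encode U)))
    ; unique   = Uniqueₚ.map⁺ (≡.setoid _) setoid decode-injective (allSubsets-unique n)
    ; _≤?_     = λ U V → Dec.map′ (λ f {x} → f x) (λ f x → f)
        (all? (λ x≈y f → Subset.resp U x≈y ∘ f ∘ Subset.resp V (Eq.sym x≈y))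
              (λ x → T? (Subset.contains V x) →-dec T? (Subset.contains U x)))
    }
  }
  where
  open FinPoset M hiding (card)
  open Search M
  n = card M

  setoid : Setoid _ _
  setoid = record
    { Carrier = Subset M
    ; _≈_ = λ U V → V ⊆ U × U ⊆ V
    ; isEquivalence = record
      { refl  = id , id
      ; sym   = λ (f , g) → g , f
      ; trans = λ (f , g) (h , k) → (λ z → f (h z)) , (λ z → k (g z))
      }
    }

  decode : FS.Subset n → Subset M
  decode S = record
    { contains = λ x → Vec.lookup S (index x)
    ; resp     = λ x≈y → ≡.subst (T ∘ Vec.lookup S) (index-cong x≈y)
    }

  encode : Subset M → FS.Subset n
  encode U = Vec.tabulate (Subset.contains U ∘ at)

  lookup-encode : ∀ U x → Vec.lookup (encode U) (index x) ≡ Subset.contains U (at (index x))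
  lookup-encode U x = Vecₚ.lookup∘tabulate _ (index x)

  decode-encode : ∀ U → Setoid._≈_ setoid (decode (encode U)) U
  decode-encode U =
      (λ {x} x∈U → ≡.subst T (≡.sym (lookup-encode U x)) (Subset.resp U (at-index x) x∈U))
    , (λ {x} x∈ → Subset.resp U (Eq.sym (at-index x)) (≡.subst T (lookup-encode U x) x∈))

  T-≡ : ∀ {b b′} → (T b → T b′) → (T b′ → T b) → b ≡ b′
  T-≡ {Bool.false} {Bool.false} _ _ = refl
  T-≡ {Bool.false} {Bool.true}  _ g = ⊥-elim (g _)
  T-≡ {Bool.true}  {Bool.false} f _ = ⊥-elim (f _)
  T-≡ {Bool.true}  {Bool.true}  _ _ = refl

  decode-injective : ∀ {S S′} → Setoid._≈_ setoid (decode S) (decode S′) → S ≡ S′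
  decode-injective {S} {S′} (f , g) =
    ≡.trans (≡.sym (Vecₚ.tabulate∘lookup S))
    (≡.trans (Vecₚ.tabulate-cong (λ i →
       ≡.subst (λ j → Vec.lookup S j ≡ Vec.lookup S′ j) (index-at i) (T-≡ (g {at i}) (f {at i}))))
    (Vecₚ.tabulate∘lookup S′))

𝓕 : (P : FinPoset c ℓ₁ ℓ₂) → FinPoset (c ⊔ ℓ₁ ⊔ ℓ₂) c c
𝓕 P = induced (reverseInclusion P) IsUpClosed
  (λ (V⊆U , U⊆V) up x y x≤y x∈V → U⊆V (up x y x≤y (V⊆U x∈V)))
  (λ U → all?
    (λ x≈x′ h y x′≤y x′∈U → h y (≤-trans (reflexive x≈x′) x′≤y) (Subset.resp U (Eq.sym x≈x′) x′∈U))
    λ x → all?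
      (λ y≈y′ h x≤y′ x∈U → Subset.resp U y≈y′ (h (≤-trans x≤y′ (reflexive (Eq.sym y≈y′))) x∈U))
      λ y → x ≤? y →-dec (T? (Subset.contains U x) →-dec T? (Subset.contains U y)))
  where
  open FinPoset P
  open Search P

Filter : FinPoset c ℓ₁ ℓ₂ → Set (c ⊔ ℓ₁ ⊔ ℓ₂)
Filter P = FinPoset.Carrier (𝓕 P)

record Cutting (L : FinDistributiveLattice c ℓ₁ ℓ₂) : Set (c ⊔ ℓ₁ ⊔ ℓ₂) where
  open FinDistributiveLattice L
  field
    0̂ 1̂   : Carrier
    0̂≤1̂   : 0̂ ≤ 1̂
    meets : (C : Subset finPoset) → IsMaximalChain C → ∃[ x ] x ∈ C × 0̂ ≤ x × x ≤ 1̂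

⟦_⟧ : {L : FinDistributiveLattice c ℓ₁ ℓ₂} → Cutting L → FinPoset _ _ _
⟦_⟧ {L = L} K = interval (FinDistributiveLattice.finPoset L) (Cutting.0̂ K) (Cutting.1̂ K)

module _ (M : FinPoset c ℓ₁ ℓ₂) where
  open FinPoset M hiding (card)
  open Search M

  private
    Comparable : Rel Carrier _
    Comparable x y = x ≤ y ⊎ y ≤ x

    comparable? : ∀ x y → Dec (Comparable x y)
    comparable? x y = x ≤? y ⊎-dec y ≤? x

    Blocked : Subset M → Pred Carrier _
    Blocked C x = ∃[ u ] u ∈ C × ¬ Comparable u x

    blocked? : ∀ (C : Subset M) x → Dec (Blocked C x)
    blocked? C x = any?
      (λ u≈v (u∈C , ¬cmp) → Subset.resp C u≈v u∈C
         , ¬cmp ∘ Sum.map (≤-trans (reflexive u≈v)) (λ x≤v → ≤-trans x≤v (reflexive (Eq.sym u≈v))))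
      (λ u → T? (Subset.contains C u) ×-dec ¬? (comparable? u x))

    insert? : ∀ (C : Subset M) x y → Dec (y ∈ C ⊎ y ≈ x)
    insert? C x y = T? (Subset.contains C y) ⊎-dec y ≈? x

    insert : Subset M → Carrier → Subset M
    insert C x = ⟪ insert? C x ⟫ λ y≈z → Sum.map (Subset.resp C y≈z) (Eq.trans (Eq.sym y≈z))

    insert-chain : ∀ (C : Subset M) x → IsChain C → ¬ Blocked C x → IsChain (insert C x)
    insert-chain C x ch ¬bl {y} {z} y∈ z∈
      with toWitness {a? = insert? C x y} y∈ | toWitness {a? = insert? C x z} z∈
    ... | inj₁ y∈C | inj₁ z∈C = ch y∈C z∈C
    ... | inj₂ y≈x | inj₂ z≈x = inj₁ (reflexive (Eq.trans y≈x (Eq.sym z≈x)))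
    ... | inj₁ y∈C | inj₂ z≈x with comparable? y x
    ...   | yes (inj₁ y≤x) = inj₁ (≤-trans y≤x (reflexive (Eq.sym z≈x)))
    ...   | yes (inj₂ x≤y) = inj₂ (≤-trans (reflexive z≈x) x≤y)
    ...   | no ¬cmp        = contradiction (y , y∈C , ¬cmp) ¬bl
    insert-chain C x ch ¬bl {y} {z} y∈ z∈ | inj₂ y≈x | inj₁ z∈C with comparable? z x
    ...   | yes (inj₁ z≤x) = inj₂ (≤-trans z≤x (reflexive (Eq.sym y≈x)))
    ...   | yes (inj₂ x≤z) = inj₁ (≤-trans (reflexive y≈x) x≤z)
    ...   | no ¬cmp        = contradiction (z , z∈C , ¬cmp) ¬bl

    saturate : ∀ (C : Subset M) → IsChain C → (xs : List Carrier) →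
               ∃[ D ] IsChain D × C ⊆ D × All (λ x → x ∈ D ⊎ Blocked D x) xs
    saturate C ch []       = C , ch , id , []
    saturate C ch (x ∷ xs) with blocked? C x
    ... | yes (u , u∈C , ¬cmp) =
      let (D , chD , C⊆D , ds) = saturate C ch xs
      in D , chD , C⊆D , inj₂ (u , C⊆D u∈C , ¬cmp) ∷ ds
    ... | no ¬bl =
      let (D , chD , C⊆D , ds) = saturate (insert C x) (insert-chain C x ch ¬bl) xs
      in D , chD
         , (λ {y} y∈C → C⊆D (fromWitness {a? = insert? C x y} (inj₁ y∈C)))
         , inj₁ (C⊆D (fromWitness {a? = insert? C x x} (inj₂ Eq.refl))) ∷ ds

  maximalChainThrough : ∀ x → ∃[ C ] IsMaximalChain {M = M} C × x ∈ C
  maximalChainThrough x =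
    let (D , chD , C⊆D , ds) = saturate C₀ ch₀ elements
    in D
     , (chD , λ V chV D⊆V {y} y∈V →
          [ id , (λ (u , u∈D , ¬cmp) → contradiction (chV (D⊆V u∈D) y∈V) ¬cmp) ]′
            (All.lookupₛ Eq.setoid
              (λ {y} {z} y≈z → Sum.map (Subset.resp D y≈z)
                 (λ (u , u∈D , ¬cmp) → u , u∈D ,
                    ¬cmp ∘ Sum.map (λ u≤z → ≤-trans u≤z (reflexive (Eq.sym y≈z)))
                                   (≤-trans (reflexive y≈z))))
              ds (complete y)))
     , C⊆D (fromWitness {a? = x ≈? x} Eq.refl)
    where
    C₀ : Subset M
    C₀ = ⟪ (_≈? x) ⟫ λ y≈z y≈x → Eq.trans (Eq.sym y≈z) y≈x

    ch₀ : IsChain C₀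
    ch₀ {y} {z} y∈ z∈ = inj₁ (reflexive
      (Eq.trans (toWitness {a? = y ≈? x} y∈) (Eq.sym (toWitness {a? = z ≈? x} z∈))))

module _ (P : FinPoset c ℓ₁ ℓ₂) (F₀ F₁ : Filter P) where
  open FinPoset P hiding (card)
  open Search P

  -- With F₀ = 0̂_K and F₁ = 1̂_K: S is 0̂_K ∖ 1̂_K, S₀ the maximal elements
  -- of P ∖ 0̂_K, S₁ the minimal elements of 1̂_K.
  S S₀ S₁ : Pred Carrier _
  S  x = x ∈ proj₁ F₀ × x ∉ proj₁ F₁
  S₀ x = x ∉ proj₁ F₀ × (∀ y → y ∉ proj₁ F₀ → x ≤ y → x ≈ y)
  S₁ x = x ∈ proj₁ F₁ × (∀ y → y ∈ proj₁ F₁ → y ≤ x → x ≈ y)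

  -- The new element x_K is nothing.
  infix 4 _≤K_
  data _≤K_ : Rel (Maybe Carrier) (c ⊔ ℓ₁ ⊔ ℓ₂) where
    old   : ∀ {x y} → x ≤ y → just x ≤K just y
    below : ∀ {z} → (∃[ s ] S₀ s × z ≤ s) → just z ≤K nothing
    above : ∀ {y} → (∃[ s ] S₁ s × s ≤ y) → nothing ≤K just y
    new   : nothing ≤K nothing

  x_K-incomparable : proj₁ F₁ ⊆ proj₁ F₀ → ∀ {z} → S z → ¬ just z ≤K nothing × ¬ nothing ≤K just z
  x_K-incomparable F₁⊆F₀ {z} (z∈F₀ , z∉F₁) =
      (λ { (below (s , (s∉F₀ , _) , z≤s)) → s∉F₀ (proj₂ F₀ z s z≤s z∈F₀) })
    , (λ { (above (s , (s∈F₁ , _) , s≤z)) → z∉F₁ (proj₂ F₁ s z s≤z s∈F₁) })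

  private
    open Subset using (resp; contains)

    S₀-resp : ∀ {x y} → x ≈ y → S₀ x → S₀ y
    S₀-resp x≈y (x∉ , max) = x∉ ∘ resp (proj₁ F₀) (Eq.sym x≈y)
      , λ z z∉ y≤z → Eq.trans (Eq.sym x≈y) (max z z∉ (≤-trans (reflexive x≈y) y≤z))

    S₁-resp : ∀ {x y} → x ≈ y → S₁ x → S₁ y
    S₁-resp x≈y (x∈ , min) = resp (proj₁ F₁) x≈y x∈
      , λ z z∈ z≤y → Eq.trans (Eq.sym x≈y) (min z z∈ (≤-trans z≤y (reflexive (Eq.sym x≈y))))

    S₀? : Decidable S₀
    S₀? x = ¬? (T? (contains (proj₁ F₀) x)) ×-dec all?
      (λ y≈z h z∉ x≤z → Eq.trans (h (z∉ ∘ resp (proj₁ F₀) y≈z)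
                                    (≤-trans x≤z (reflexive (Eq.sym y≈z)))) y≈z)
      (λ y → ¬? (T? (contains (proj₁ F₀) y)) →-dec (x ≤? y →-dec x ≈? y))

    S₁? : Decidable S₁
    S₁? x = T? (contains (proj₁ F₁) x) ×-dec all?
      (λ y≈z h z∈ z≤x → Eq.trans (h (resp (proj₁ F₁) (Eq.sym y≈z) z∈)
                                    (≤-trans (reflexive y≈z) z≤x)) y≈z)
      (λ y → T? (contains (proj₁ F₁) y) →-dec (y ≤? x →-dec x ≈? y))

    _≤K?_ : ∀ x y → Dec (x ≤K y)
    just x  ≤K? just y  = Dec.map′ old (λ { (old x≤y) → x≤y }) (x ≤? y)
    just z  ≤K? nothing = Dec.map′ below (λ { (below w) → w })
      (any? (λ s≈t (s∈ , z≤s) → S₀-resp s≈t s∈ , ≤-trans z≤s (reflexive s≈t))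
            (λ s → S₀? s ×-dec z ≤? s))
    nothing ≤K? just y  = Dec.map′ above (λ { (above w) → w })
      (any? (λ s≈t (s∈ , s≤y) → S₁-resp s≈t s∈ , ≤-trans (reflexive (Eq.sym s≈t)) s≤y)
            (λ s → S₁? s ×-dec s ≤? y))
    nothing ≤K? nothing = yes new

  -- S₀ lies below S₁ whenever F₀ and F₁ bound a cutting (see separated);
  -- without this _≤K_ is not transitive.
  module _ (F₁⊆F₀ : proj₁ F₁ ⊆ proj₁ F₀) (S₀≤S₁ : ∀ {s t} → S₀ s → S₁ t → s ≤ t) where

    private
      ≈K-setoid : Setoid _ _
      ≈K-setoid = Pointwise.setoid Eq.setoid

      ≤K-reflexive : ∀ {x y} → Pointwise _≈_ x y → x ≤K y
      ≤K-reflexive (just x≈y) = old (reflexive x≈y)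
      ≤K-reflexive nothing    = new

      ≤K-trans : ∀ {x y z} → x ≤K y → y ≤K z → x ≤K z
      ≤K-trans (old x≤y)              (old y≤z)              = old (≤-trans x≤y y≤z)
      ≤K-trans (old x≤y)              (below (s , s∈ , y≤s)) = below (s , s∈ , ≤-trans x≤y y≤s)
      ≤K-trans (below (s , s∈ , x≤s)) (above (t , t∈ , t≤z)) =
        old (≤-trans x≤s (≤-trans (S₀≤S₁ s∈ t∈) t≤z))
      ≤K-trans (below w)              new                    = below w
      ≤K-trans (above (t , t∈ , t≤y)) (old y≤z)              = above (t , t∈ , ≤-trans t≤y y≤z)
      ≤K-trans (above _)              (below _)              = new
      ≤K-trans new                    y≤z                    = y≤z

      ≤K-antisym : ∀ {x y} → x ≤K y → y ≤K x → Pointwise _≈_ x y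
      ≤K-antisym (old x≤y) (old y≤x) = just (antisym x≤y y≤x)
      ≤K-antisym (below (s , (s∉ , _) , z≤s)) (above (t , (t∈ , _) , t≤z)) =
        contradiction (proj₂ F₀ _ _ z≤s (F₁⊆F₀ (proj₂ F₁ _ _ t≤z t∈))) s∉
      ≤K-antisym (above (t , (t∈ , _) , t≤z)) (below (s , (s∉ , _) , z≤s)) =
        contradiction (proj₂ F₀ _ _ z≤s (F₁⊆F₀ (proj₂ F₁ _ _ t≤z t∈))) s∉
      ≤K-antisym new new = nothing

    adjoin : FinPoset c (c ⊔ ℓ₁) (c ⊔ ℓ₁ ⊔ ℓ₂)
    adjoin = record
      { poset = record
        { Carrier = Maybe Carrier
        ; _≈_ = Pointwise _≈_
        ; _≤_ = _≤K_
        ; isPartialOrder = record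
          { isPreorder = record
            { isEquivalence = Setoid.isEquivalence ≈K-setoid
            ; reflexive = ≤K-reflexive
            ; trans = ≤K-trans
            }
          ; antisym = ≤K-antisym
          }
        }
      ; isFinite = record
        { elements = nothing ∷ map just elements
        ; complete = λ
          { nothing  → here nothing
          ; (just x) → there (Membershipₚ.∈-map⁺ Eq.setoid ≈K-setoid just (complete x)) }
        ; unique = All.tabulateₛ ≈K-setoid
              nothing≉just
            ∷ Uniqueₚ.map⁺ Eq.setoid ≈K-setoid (λ { (just x≈y) → x≈y }) unique
        ; _≤?_ = _≤K?_
        }
      }
      where
      nothing≉just : ∀ {y} → Membership._∈_ ≈K-setoid y (map just elements) → ¬ Pointwise _≈_ nothing y
      nothing≉just y∈ nothing with Membershipₚ.∈-map⁻ Eq.setoid ≈K-setoid y∈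
      ... | _ , _ , ()

-- L ⊞ K is defined through a representation φ of L as a lattice of
-- filters, which carries 0̂_K and 1̂_K to filters of P.
module _ {L : FinDistributiveLattice c ℓ₁ ℓ₂} {P : FinPoset c′ ℓ₁′ ℓ₂′}
         (φ : FinDistributiveLattice.finPoset L ≅ 𝓕 P) (K : Cutting L) where
  private
    module L = FinPoset (FinDistributiveLattice.finPoset L)
    module φ = _≅_ φ
    module K = Cutting K
    open FinPoset P hiding (card)

    F₀ F₁ : Filter P
    F₀ = φ.to K.0̂
    F₁ = φ.to K.1̂

    notBelow : Carrier → Filter P
    notBelow t = ⟪ (λ x → ¬? (x ≤? t)) ⟫ (λ x≈y x≰t y≤t → x≰t (≤-trans (reflexive x≈y) y≤t))
      , λ x y x≤y x∈ → fromWitness {a? = ¬? (y ≤? t)}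
          (λ y≤t → toWitness {a? = ¬? (x ≤? t)} x∈ (≤-trans x≤y y≤t))

  -- If s ≰ t, a maximal chain through the filter P ∖ ↓ t misses K, because
  -- that filter contains s ∉ 0̂_K and omits t ∈ 1̂_K.
  separated : ∀ {s t} → S₀ P F₀ F₁ s → S₁ P F₀ F₁ t → s ≤ t
  separated {s} {t} (s∉F₀ , _) (t∈F₁ , _) with s ≤? t
  ... | yes s≤t = s≤t
  ... | no  s≰t =
    let (a , to-a)             = φ.surjective (notBelow t)
        (N⊆φa , φa⊆N)          = to-a L.Eq.refl
        (C , max , a∈C)        = maximalChainThrough (FinDistributiveLattice.finPoset L) a
        (x , x∈C , 0̂≤x , x≤1̂) = K.meets C max
    in ⊥-elim ([ (λ a≤x → toWitness {a? = ¬? (t ≤? t)}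
                   (φa⊆N (φ.mono a≤x (φ.mono x≤1̂ t∈F₁))) ≤-refl)
               , (λ x≤a → s∉F₀ (φ.mono 0̂≤x (φ.mono x≤a
                   (N⊆φa (fromWitness {a? = ¬? (s ≤? t)} s≰t)))))
               ]′ (proj₁ max a∈C x∈C))

  P_K : FinPoset _ _ _
  P_K = adjoin P F₀ F₁ (φ.mono K.0̂≤1̂) separated

  convexExpansion : FinPoset _ _ _
  convexExpansion = 𝓕 P_K

infixl 6 _⊞[_]_

_⊞[_]_ : (L : FinDistributiveLattice c ℓ₁ ℓ₂) {P : FinPoset c′ ℓ₁′ ℓ₂′} →
         FinDistributiveLattice.finPoset L ≅ 𝓕 P → Cutting L → FinPoset _ _ _
L ⊞[ φ ] K = convexExpansion {L = L} φ K

{-# OPTIONS --safe #-}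
module Submission where

-- A filter of P_K is a filter of P with or without x_K; it may contain x_K iff
-- it lies below 1̂ in L and may omit x_K iff it lies above 0̂.  Hence L ⊞ K is
-- the subposet {(a , 0) : a ≤ 1̂} ∪ {(a , 1) : 0̂ ≤ a} of L × {0 < 1}, where every
-- a ∈ L satisfies a ≤ 1̂ or 0̂ ≤ a because K meets a maximal chain through a.
-- Using complements, a Boolean interval [a , b] of L has b ≤ 1̂ or 0̂ ≤ a, so the
-- Boolean intervals inside one of the two copies number q_k(L) + q_k(K).  One
-- from (a , 0) to (b , 1) must have 0̂ ≤ a and b ≤ 1̂; it is then [a , b] × {0 < 1},
-- which is 𝐁 k iff [a , b] is 𝐁 (k − 1), and this gives q_{k−1}(K).

open import Data.Bool.Base using (true; false; T)
open import Data.Bool.Properties using (T?)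
open import Data.Fin.Base using (zero; suc)
import Data.Fin.Properties as Fin
import Data.Fin.Subset as FS
import Data.Fin.Subset.Properties as FSₚ
open import Data.Integer.Base using (+_) renaming (_-_ to _-ᶻ_)
open import Data.List.Base as List using (List; []; _∷_; _++_; map; length; cartesianProduct)
import Data.List.Membership.Setoid as Membership
import Data.List.Membership.Setoid.Properties as Membershipₚ
open import Data.List.Membership.Propositional.Properties using (∈-lookup)
open import Data.List.Properties using (length-++; length-map)
open import Data.List.Relation.Unary.All as All using (All; []; _∷_)
import Data.List.Relation.Unary.All.Properties as Allₚ
open import Data.List.Relation.Unary.AllPairs using ([])
import Data.List.Relation.Unary.Any as Any
import Data.List.Relation.Unary.Any.Properties as Anyₚ
open import Data.List.Relation.Unary.Unique.Setoid using (Unique)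
import Data.List.Relation.Unary.Unique.Setoid.Properties as Uniqueₚ
open import Data.Maybe.Base using (just; nothing)
open import Data.Maybe.Relation.Binary.Pointwise using (just; nothing)
open import Data.Nat.Base using (ℕ; zero; suc; _+_) renaming (_≤_ to _≤ⁿ_)
import Data.Nat.Properties as ℕ
open import Data.Product.Base using (Σ; ∃-syntax; _×_; _,_; proj₁; proj₂)
open import Data.Product.Relation.Binary.Pointwise.NonDependent using (_×ₛ_)
open import Data.Sum.Base as Sum using (_⊎_; inj₁; inj₂; [_,_]′)
open import Data.Sum.Relation.Binary.Pointwise using (_⊎ₛ_; inj₁; inj₂)
open import Data.Sum.Relation.Unary.All as Sum-All using (inj₁; inj₂)
open import Data.Vec.Base using ([]; _∷_; here; there; insertAt; removeAt)
import Data.Vec.Properties as Vecₚ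
open import Data.Unit.Base using (⊤)
open import Function.Base using (_∘_; id; case_of_)
open import Level using (Level; _⊔_)
open import Relation.Binary.Bundles using (Setoid; Poset)
open import Relation.Binary.Core using (REL)
open import Relation.Binary.Lattice.Bundles using (DistributiveLattice)
open import Relation.Binary.Morphism.Construct.Composition using (isOrderIsomorphism)
import Relation.Binary.Properties.Poset as Posetₚ
open import Relation.Binary.PropositionalEquality as ≡ using (_≡_; refl; sym; trans; cong; subst; module ≡-Reasoning)
open import Relation.Nullary.Decidable using (Dec; yes; no; ¬?; decidable-stable; _×-dec_)
open import Relation.Nullary.Negation using (¬_; contradiction)
open import Relation.Unary using (Pred; Decidable)
-- Read as mixfix operators, these two names would reserve x, P and K.
open import Defs hiding (x_K-incomparable; P_K)

private
  variable
    a b c c′ c″ ℓ ℓ′ ℓ₁ ℓ₁′ ℓ₁″ ℓ₂ ℓ₂′ ℓ₂″ p q′ r : Level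

-- Counting

-- Cardinality up to `_≈_`, witnessed by any repetition-free list. The list need not come from a
-- filter, so `Q` need not be decidable.
record Counts (S : Setoid a ℓ) (Q : Pred (Setoid.Carrier S) p) (n : ℕ) : Set (a ⊔ ℓ ⊔ p) where
  field
    list     : List (Setoid.Carrier S)
    unique   : Unique S list
    sound    : All Q list
    complete : ∀ {x} → Q x → Membership._∈_ S x list
    size     : length list ≡ n

Counts-∅ : {S : Setoid a ℓ} {Q : Pred (Setoid.Carrier S) p} → (∀ {x} → ¬ Q x) → Counts S Q 0
Counts-∅ empty = record
  { list = [] ; unique = [] ; sound = [] ; complete = λ qx → contradiction qx empty ; size = refl }

Counts-resp : {S : Setoid a ℓ} {Q : Pred (Setoid.Carrier S) p} {R : Pred (Setoid.Carrier S) r} →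
              (∀ {x} → Q x → R x) → (∀ {x} → R x → Q x) → ∀ {n} → Counts S Q n → Counts S R n
Counts-resp Q⇒R R⇒Q A = record
  { list = list ; unique = unique ; sound = All.map Q⇒R sound ; complete = complete ∘ R⇒Q ; size = size }
  where open Counts A

Counts-⊎ : {S : Setoid a ℓ} {T : Setoid b ℓ′} {Q : Pred (Setoid.Carrier S) p} {R : Pred (Setoid.Carrier T) r} →
           ∀ {m n} → Counts S Q m → Counts T R n → Counts (S ⊎ₛ T) (Sum-All.All Q R) (m + n)
Counts-⊎ {S = S} {T = T} A B = record
  { list     = map inj₁ A.list ++ map inj₂ B.list
  ; unique   = Uniqueₚ.++⁺ (S ⊎ₛ T)
      (Uniqueₚ.map⁺ S (S ⊎ₛ T) (λ { (inj₁ eq) → eq }) A.unique)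
      (Uniqueₚ.map⁺ T (S ⊎ₛ T) (λ { (inj₂ eq) → eq }) B.unique)
      λ (v∈ , v∈′) →
        let (_ , _ , v≈)  = Membershipₚ.∈-map⁻ S (S ⊎ₛ T) v∈
            (_ , _ , v≈′) = Membershipₚ.∈-map⁻ T (S ⊎ₛ T) v∈′
        in disjoint v≈ v≈′
  ; sound    = Allₚ.++⁺ (Allₚ.map⁺ (All.map inj₁ A.sound)) (Allₚ.map⁺ (All.map inj₂ B.sound))
  ; complete = λ
      { (inj₁ q) → Membershipₚ.∈-++⁺ˡ (S ⊎ₛ T) (Membershipₚ.∈-map⁺ S (S ⊎ₛ T) inj₁ (A.complete q))
      ; (inj₂ q) → Membershipₚ.∈-++⁺ʳ (S ⊎ₛ T) _ (Membershipₚ.∈-map⁺ T (S ⊎ₛ T) inj₂ (B.complete q)) }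
  ; size     = trans (length-++ (map inj₁ A.list))
      (≡.cong₂ _+_ (trans (length-map inj₁ A.list) A.size) (trans (length-map inj₂ B.list) B.size))
  }
  where
  module A = Counts A
  module B = Counts B
  disjoint : ∀ {v x y} → Setoid._≈_ (S ⊎ₛ T) v (inj₁ x) → ¬ Setoid._≈_ (S ⊎ₛ T) v (inj₂ y)
  disjoint (inj₁ _) ()

Counts-card : (M : FinPoset c ℓ₁ ℓ₂) → Counts (FinPoset.Eq.setoid M) (λ _ → ⊤) (card M)
Counts-card M = record
  { list = elements ; unique = unique ; sound = All.universal _ elements
  ; complete = λ {x} _ → complete x ; size = refl }
  where open FinPoset M

-- A relation that is injective and total in one direction plays the role of
-- an injective map, without a choice of representatives.
Counts-≤ : {S : Setoid a ℓ} {T : Setoid b ℓ′}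
           {Q : Pred (Setoid.Carrier S) p} {Q′ : Pred (Setoid.Carrier T) q′} →
           (R : REL (Setoid.Carrier S) (Setoid.Carrier T) r) →
           (∀ {x y y′} → Setoid._≈_ T y y′ → R x y → R x y′) →
           (∀ {x x′ y} → R x y → R x′ y → Setoid._≈_ S x x′) →
           (∀ {x} → Q x → ∃[ y ] Q′ y × R x y) →
           ∀ {m n} → Counts S Q m → Counts T Q′ n → m ≤ⁿ n
Counts-≤ {S = S} {T = T} R resp injective total A B =
  -- Sizes are compared by an injection from positions in the first list to positions in the second.
  ≡.subst₂ _≤ⁿ_ A.size B.size (Fin.injective⇒≤ {f = proj₁ ∘ f} λ {i} {j} eq →
    lookup-injective S A.unique i j
      (injective (proj₂ (f i)) (subst (R _ ∘ List.lookup B.list) (sym eq) (proj₂ (f j)))))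
  where
  module A = Counts A
  module B = Counts B
  f : ∀ i → ∃[ j ] R (List.lookup A.list i) (List.lookup B.list j)
  f i = let (y , q , xRy) = total (All.lookup A.sound (∈-lookup i))
            y∈            = B.complete q
        in Any.index y∈ , resp (Anyₚ.lookup-index y∈) xRy

-- `R` and its converse give the two inequalities, so a matching described by cases suffices and no
-- inverse functions have to be compared.
Counts-≡ : {S : Setoid a ℓ} {T : Setoid b ℓ′}
           {Q : Pred (Setoid.Carrier S) p} {Q′ : Pred (Setoid.Carrier T) q′} →
           (R : REL (Setoid.Carrier S) (Setoid.Carrier T) r) →
           (∀ {x x′ y} → Setoid._≈_ S x x′ → R x y → R x′ y) →
           (∀ {x y y′} → Setoid._≈_ T y y′ → R x y → R x y′) →
           (∀ {x x′ y} → R x y → R x′ y → Setoid._≈_ S x x′) →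
           (∀ {x y y′} → R x y → R x y′ → Setoid._≈_ T y y′) →
           (∀ {x} → Q x → ∃[ y ] Q′ y × R x y) →
           (∀ {y} → Q′ y → ∃[ x ] Q x × R x y) →
           ∀ {m n} → Counts S Q m → Counts T Q′ n → m ≡ n
Counts-≡ R respˡ respʳ injˡ injʳ totalˡ totalʳ A B = ℕ.≤-antisym
  (Counts-≤ R respʳ injˡ totalˡ A B)
  (Counts-≤ (λ y x → R x y) respˡ injʳ totalʳ B A)

-- Order isomorphisms

module _ {M : FinPoset c ℓ₁ ℓ₂} {N : FinPoset c′ ℓ₁′ ℓ₂′} where
  private
    module M = FinPoset M
    module N = FinPoset N

  -- Congruence and injectivity come for free: both follow by antisymmetry from monotonicity and
  -- order reflection.
  mk≅ : (f : M.Carrier → N.Carrier) →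
        (∀ {x y} → x M.≤ y → f x N.≤ f y) →
        (∀ {x y} → f x N.≤ f y → x M.≤ y) →
        (∀ y → ∃[ x ] f x N.≈ y) → M ≅ N
  mk≅ f mono cancel surjective = record
    { to = f
    ; isOrderIsomorphism = record
      { isOrderMonomorphism = record
        { isOrderHomomorphism = record { cong = f-cong ; mono = mono }
        ; injective = λ fx≈fy → M.antisym (cancel (N.reflexive fx≈fy))
                                          (cancel (N.reflexive (N.Eq.sym fx≈fy)))
        ; cancel = cancel
        }
      ; surjective = λ y → let (x , fx≈y) = surjective y in
          x , λ z≈x → N.Eq.trans (f-cong z≈x) fx≈y
      }
    }
    where
    f-cong : ∀ {x y} → x M.≈ y → f x N.≈ f y
    f-cong x≈y = N.antisym (mono (M.reflexive x≈y)) (mono (M.reflexive (M.Eq.sym x≈y)))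

  module _ (φ : M ≅ N) where
    open _≅_ φ using (to; surjective)

    from : N.Carrier → M.Carrier
    from y = proj₁ (surjective y)

    to-from : ∀ y → to (from y) N.≈ y
    to-from y = proj₂ (surjective y) M.Eq.refl

    from-adjointʳ : ∀ {x y} → to x N.≤ y → x M.≤ from y
    from-adjointʳ {y = y} le = _≅_.cancel φ (N.≤-trans le (N.reflexive (N.Eq.sym (to-from y))))

    from-adjointˡ : ∀ {x y} → y N.≤ to x → from y M.≤ x
    from-adjointˡ {y = y} le = _≅_.cancel φ (N.≤-trans (N.reflexive (to-from y)) le)

≅-sym : {M : FinPoset c ℓ₁ ℓ₂} {N : FinPoset c′ ℓ₁′ ℓ₂′} → M ≅ N → N ≅ M
≅-sym {M = M} {N = N} φ = mk≅ (from φ)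
  (λ y≤z → from-adjointˡ φ (N.≤-trans y≤z (N.reflexive (N.Eq.sym (to-from φ _)))))
  (λ le → N.≤-trans (N.reflexive (N.Eq.sym (to-from φ _)))
            (N.≤-trans (φ.mono le) (N.reflexive (to-from φ _))))
  (λ x → φ.to x , φ.injective (to-from φ _))
  where
  module N = FinPoset N
  module φ = _≅_ φ

≅-trans : {M : FinPoset c ℓ₁ ℓ₂} {N : FinPoset c′ ℓ₁′ ℓ₂′} {O : FinPoset c″ ℓ₁″ ℓ₂″} →
          M ≅ N → N ≅ O → M ≅ O
≅-trans {O = O} φ ψ = record
  { isOrderIsomorphism =
      isOrderIsomorphism (FinPoset.Eq.trans O) (_≅_.isOrderIsomorphism φ) (_≅_.isOrderIsomorphism ψ) }

interval-≅ : (M : FinPoset c ℓ₁ ℓ₂) → let open FinPoset M in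
             ∀ {a a′ b b′} → a ≈ a′ → b ≈ b′ → interval M a b ≅ interval M a′ b′
interval-≅ M a≈a′ b≈b′ = mk≅
  (λ (x , a≤x , x≤b) → x , ≤-trans (reflexive (Eq.sym a≈a′)) a≤x , ≤-trans x≤b (reflexive b≈b′))
  id id
  (λ (x , a≤x , x≤b) → (x , ≤-trans (reflexive a≈a′) a≤x , ≤-trans x≤b (reflexive (Eq.sym b≈b′))) , Eq.refl)
  where open FinPoset M

-- Counting Boolean intervals

IsBooleanInterval-resp : (M : FinPoset c ℓ₁ ℓ₂) (k : ℕ) → let open FinPoset M in
                         ∀ {u v} → Setoid._≈_ (Eq.setoid ×ₛ Eq.setoid) u v →
                         IsBooleanInterval M k u → IsBooleanInterval M k v
IsBooleanInterval-resp M k (a≈a′ , b≈b′) (a≤b , ψ) =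
  ≤-trans (reflexive (Eq.sym a≈a′)) (≤-trans a≤b (reflexive b≈b′)) ,
  ≅-trans (interval-≅ M (Eq.sym a≈a′) (Eq.sym b≈b′)) ψ
  where open FinPoset M

Counts-q : (M : FinPoset c ℓ₁ ℓ₂) (k : ℕ) →
           Counts (FinPoset.Eq.setoid M ×ₛ FinPoset.Eq.setoid M) (IsBooleanInterval M k) (q (+ k) M)
Counts-q M k = record
  { list     = _
  ; unique   = Uniqueₚ.filter⁺ (Eq.setoid ×ₛ Eq.setoid) (isBooleanInterval? M k)
                 (Uniqueₚ.cartesianProduct⁺ Eq.setoid Eq.setoid unique unique)
  ; sound    = Allₚ.all-filter (isBooleanInterval? M k) (cartesianProduct elements elements)
  ; complete = Membershipₚ.∈-filter⁺ (Eq.setoid ×ₛ Eq.setoid) (isBooleanInterval? M k)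
                 (IsBooleanInterval-resp M k)
                 (Membershipₚ.∈-cartesianProduct⁺ Eq.setoid Eq.setoid (complete _) (complete _))
  ; size     = refl
  }
  where open FinPoset M

q₀≡card : (M : FinPoset c ℓ₁ ℓ₂) → q (+ 0) M ≡ card M
q₀≡card M = Counts-≡
  (λ (a , b) x → a ≈ x × b ≈ x)
  (λ (a≈a′ , b≈b′) (a≈x , b≈x) → Eq.trans (Eq.sym a≈a′) a≈x , Eq.trans (Eq.sym b≈b′) b≈x)
  (λ x≈y (a≈x , b≈x) → Eq.trans a≈x x≈y , Eq.trans b≈x x≈y)
  (λ (a≈x , b≈x) (a′≈x , b′≈x) → Eq.trans a≈x (Eq.sym a′≈x) , Eq.trans b≈x (Eq.sym b′≈x))
  (λ (a≈x , _) (a≈y , _) → Eq.trans (Eq.sym a≈x) a≈y)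
  (λ {(a , b)} (a≤b , ψ) → a , _ , Eq.refl ,
     -- Over an empty index set every inclusion holds vacuously, so reflecting it along `ψ` gives
     -- `b ≤ a`.
     antisym (_≅_.cancel ψ {b , a≤b , ≤-refl} {a , ≤-refl , a≤b} λ { {()} }) a≤b)
  (λ {x} _ → (x , x) ,
     (≤-refl , mk≅ {N = 𝐁 0} (λ _ → []) (λ _ {_} → id) (λ {(_ , _ , y≤x)} {(_ , x≤z , _)} _ → ≤-trans y≤x x≤z)
                 (λ { [] → (x , ≤-refl , ≤-refl) , refl })) ,
     Eq.refl , Eq.refl)
  (Counts-q M 0) (Counts-card M)
  where open FinPoset M hiding (card)

-- Boolean intervals

module _ (M : FinPoset c ℓ₁ ℓ₂) {a b : FinPoset.Carrier M} {k : ℕ} (ψ : interval M a b ≅ 𝐁 k) where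
  open FinPoset M hiding (card)
  private
    module ψ = _≅_ ψ

  -- Transports the set complement back along `ψ`. The meet and join laws are phrased through common
  -- bounds, because `M` is only a poset.
  complement : ∀ x → a ≤ x → x ≤ b → ∃[ y ] a ≤ y × y ≤ b ×
               (∀ z → a ≤ z → z ≤ x → z ≤ y → z ≤ a) ×
               (∀ z → z ≤ b → x ≤ z → y ≤ z → b ≤ z)
  complement x a≤x x≤b =
    let X                = x , a≤x , x≤b
        (y , a≤y , y≤b)  = from ψ (FS.∁ (ψ.to X))
        a≤b              = ≤-trans a≤x x≤b
    in y , a≤y , y≤b
     , (λ z a≤z z≤x z≤y → ψ.cancel {z , a≤z , ≤-trans z≤x x≤b} {a , ≤-refl , a≤b} λ i∈z →
          contradiction (ψ.mono z≤x i∈z)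
            (FSₚ.x∈∁p⇒x∉p (subst (_ FS.∈_) (to-from ψ _) (ψ.mono z≤y i∈z))))
     -- Every index lies in the subset of `x` or in its complement, hence in that of any upper bound
     -- of `x` and `y`.
     , (λ z z≤b x≤z y≤z → ψ.cancel {b , a≤b , ≤-refl} {z , ≤-trans a≤x x≤z , z≤b} λ {i} _ →
          [ ψ.mono x≤z , ψ.mono y≤z ∘ subst (_ FS.∈_) (sym (to-from ψ _)) ]′
            (∈-or-∈∁ i (ψ.to X)))
    where
    ∈-or-∈∁ : ∀ {n} i (U : FS.Subset n) → i FS.∈ U ⊎ i FS.∈ FS.∁ U
    ∈-or-∈∁ i U with i FSₚ.∈? U
    ... | yes i∈U = inj₁ i∈U
    ... | no  i∉U = inj₂ (FSₚ.x∉p⇒x∈∁p i∉U)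

removeAt-mono : ∀ {n} i {U V : FS.Subset (suc n)} → U FS.⊆ V → removeAt U i FS.⊆ removeAt V i
removeAt-mono zero    {_ ∷ _}     {_ ∷ _}     U⊆V = FSₚ.drop-∷-⊆ U⊆V
removeAt-mono (suc i) {_ ∷ _ ∷ _} {_ ∷ _ ∷ _} U⊆V here      = case U⊆V here of λ { here → here }
removeAt-mono (suc i) {_ ∷ _ ∷ _} {_ ∷ _ ∷ _} U⊆V (there j) = there (removeAt-mono i (FSₚ.drop-∷-⊆ U⊆V) j)

-- Removal forgets only position `i`, where membership of `i` in `V` leaves nothing to check.
removeAt-cancel : ∀ {n} i {U V : FS.Subset (suc n)} → i FS.∈ V → removeAt U i FS.⊆ removeAt V i → U FS.⊆ V
removeAt-cancel zero    {_ ∷ _}     {_ ∷ _}     here        le here      = here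
removeAt-cancel zero    {_ ∷ _}     {_ ∷ _}     here        le (there j) = there (le j)
removeAt-cancel (suc i) {_ ∷ _ ∷ _} {_ ∷ _ ∷ _} (there i∈V) le here      = case le here of λ { here → here }
removeAt-cancel (suc i) {_ ∷ _ ∷ _} {_ ∷ _ ∷ _} (there i∈V) le (there j) =
  there (removeAt-cancel i i∈V (FSₚ.drop-∷-⊆ le) j)

-- The atom w corresponds to a singleton {i}, and [w , b] to the subsets
-- containing i.
above-atom : (M : FinPoset c ℓ₁ ℓ₂) → let open FinPoset M in
             ∀ {a b w k} → interval M a b ≅ 𝐁 k → a ≤ w → w ≤ b → ¬ w ≤ a →
             (∀ z → a ≤ z → z ≤ w → z ≤ a ⊎ w ≤ z) →
             ∃[ j ] k ≡ suc j × interval M w b ≅ 𝐁 j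
above-atom M {a} {b} {w} {k} ψ a≤w w≤b w≰a atom with FSₚ.nonempty? (_≅_.to ψ (w , a≤w , w≤b))
... | no empty = contradiction
  (_≅_.cancel ψ {y = a , ≤-refl , ≤-trans a≤w w≤b} λ i∈w → contradiction (_ , i∈w) empty) w≰a
  where open FinPoset M
... | yes (i , i∈w) with k
-- The index `i : Fin k` rules out `k = 0`.
...   | suc j = j , refl , mk≅
  (λ x → removeAt (ψ.to (widen x)) i)
  (λ x≤y → removeAt-mono i (ψ.mono x≤y))
  (λ {x} {y} le → ψ.cancel {widen x} {widen y} (removeAt-cancel i (ψ.mono (proj₁ (proj₂ y)) i∈w) le))
  -- Insertion of `i` inverts its removal, and `w≤from` keeps the resulting element above `w`.
  (λ U → let V = insertAt U i FS.inside
             (x , a≤x , x≤b) = from ψ V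
             i∈V = Vecₚ.lookup⇒[]= i V (Vecₚ.insertAt-lookup U i FS.inside)
         in (x , w≤from i∈V , x≤b) , trans (cong (λ W → removeAt W i) (trans (ψ.cong Eq.refl) (to-from ψ V)))
                                          (Vecₚ.removeAt-insertAt U i FS.inside))
  where
  open FinPoset M
  module ψ = _≅_ ψ
  W = w , a≤w , w≤b

  widen : FinPoset.Carrier (interval M w b) → FinPoset.Carrier (interval M a b)
  widen (x , w≤x , x≤b) = x , ≤-trans a≤w w≤x , x≤b

  -- The preimage of the singleton lies below `w` but not below `a`; the atom hypothesis then places
  -- `w` below it.
  ⁅i⁆ : FinPoset.Carrier (interval M a b)
  ⁅i⁆ = from ψ FS.⁅ i ⁆

  ⁅i⁆≤w : proj₁ ⁅i⁆ ≤ w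
  ⁅i⁆≤w = from-adjointˡ ψ {W} λ j∈ → subst (FS._∈ ψ.to W) (sym (FSₚ.x∈⁅y⁆⇒x≡y i j∈)) i∈w

  ⁅i⁆≰a : ¬ proj₁ ⁅i⁆ ≤ a
  ⁅i⁆≰a le = FSₚ.∉⊥ (subst (i FS.∈_) (to-from ψ FS.⊥)
    (ψ.mono {⁅i⁆} {from ψ FS.⊥} (≤-trans le (proj₁ (proj₂ (from ψ FS.⊥))))
      (subst (i FS.∈_) (sym (to-from ψ FS.⁅ i ⁆)) (FSₚ.x∈⁅x⁆ i))))

  w≤⁅i⁆ : w ≤ proj₁ ⁅i⁆
  w≤⁅i⁆ = [ (λ le → contradiction le ⁅i⁆≰a) , id ]′ (atom _ (proj₁ (proj₂ ⁅i⁆)) ⁅i⁆≤w)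

  w≤from : ∀ {V} → i FS.∈ V → w ≤ proj₁ (from ψ V)
  w≤from {V} i∈V = ≤-trans w≤⁅i⁆ (from-adjointʳ ψ {⁅i⁆} λ j∈ →
    subst (FS._∈ V) (sym (FSₚ.x∈⁅y⁆⇒x≡y i (subst (_ FS.∈_) (to-from ψ FS.⁅ i ⁆) j∈))) i∈V)

-- Expansions along a cutting

-- A maximal chain through `a` contains some `x` of `K`. If `a ≤ x`, then `x ≤ 1̂` bounds `a`; if
-- `x ≤ a`, then `0̂ ≤ x` does.
cutting-dichotomy : {L : FinDistributiveLattice c ℓ₁ ℓ₂} (K : Cutting L) →
                    let open FinDistributiveLattice L; open Cutting K in
                    ∀ a → a ≤ 1̂ ⊎ 0̂ ≤ a
cutting-dichotomy {L = L} K a =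
  let (C , max , a∈C)        = maximalChainThrough finPoset a
      (x , x∈C , 0̂≤x , x≤1̂) = meets C max
  in Sum.map (λ a≤x → ≤-trans a≤x x≤1̂) (≤-trans 0̂≤x) (proj₁ max a∈C x∈C)
  where
  open FinDistributiveLattice L using (finPoset)
  open FinPoset finPoset using (≤-trans)
  open Cutting K

-- in₀ a and in₁ a stand for (a , 0) and (a , 1).
record IsExpansion {L : FinDistributiveLattice c ℓ₁ ℓ₂} (K : Cutting L) (M : FinPoset c′ ℓ₁′ ℓ₂′) :
                   Set (c ⊔ ℓ₂ ⊔ c′ ⊔ ℓ₁′ ⊔ ℓ₂′) where
  open FinDistributiveLattice L
  open Cutting K
  private
    module M = FinPoset M
  field
    in₀         : ∀ a → a ≤ 1̂ → M.Carrier
    in₁         : ∀ a → 0̂ ≤ a → M.Carrier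
    -- As `p` and `q` are arbitrary, the case `a = b` also says that `in₀ a` does not depend on its
    -- proof.
    in₀-mono    : ∀ {a b p q} → a ≤ b → in₀ a p M.≤ in₀ b q
    in₀-cancel  : ∀ {a b p q} → in₀ a p M.≤ in₀ b q → a ≤ b
    in₁-mono    : ∀ {a b p q} → a ≤ b → in₁ a p M.≤ in₁ b q
    in₁-cancel  : ∀ {a b p q} → in₁ a p M.≤ in₁ b q → a ≤ b
    in₀₁-mono   : ∀ {a b p q} → a ≤ b → in₀ a p M.≤ in₁ b q
    in₀₁-cancel : ∀ {a b p q} → in₀ a p M.≤ in₁ b q → a ≤ b
    in₁≰in₀     : ∀ {a b p q} → ¬ in₁ a p M.≤ in₀ b q
    split       : ∀ x → (∃[ a ] Σ (a ≤ 1̂) λ p → x M.≈ in₀ a p) ⊎ (∃[ a ] Σ (0̂ ≤ a) λ p → x M.≈ in₁ a p)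

module _ {L : FinDistributiveLattice c ℓ₁ ℓ₂} (K : Cutting L) where
  open FinDistributiveLattice L using (distributiveLattice; finPoset)
  open Cutting K
  open DistributiveLattice distributiveLattice using (_∨_; _∧_; x≤x∨y; y≤x∨y; ∨-least; x∧y≤x; x∧y≤y; ∧-greatest)
  private
    module L = FinPoset finPoset
    open L using (_≤_; ≤-trans; ≤-refl)

    dichotomy : ∀ a → a ≤ 1̂ ⊎ 0̂ ≤ a
    dichotomy = cutting-dichotomy K

  -- The complement of a ∨ 0̂ in [a , b] lies above 0̂ or below 1̂.
  booleanInterval-dichotomy : ∀ {a b k} → IsBooleanInterval finPoset k (a , b) → b ≤ 1̂ ⊎ 0̂ ≤ a
  booleanInterval-dichotomy {a} {b} (a≤b , ψ) with dichotomy b | dichotomy a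
  ... | inj₁ b≤1̂ | _         = inj₁ b≤1̂
  ... | inj₂ _    | inj₂ 0̂≤a = inj₂ 0̂≤a
  ... | inj₂ 0̂≤b | inj₁ a≤1̂ with complement finPoset ψ (a ∨ 0̂) (x≤x∨y a 0̂) (∨-least a≤b 0̂≤b)
  ...   | d , a≤d , d≤b , meet , join with dichotomy d
  -- `b ∧ 1̂` is an upper bound of `a ∨ 0̂` and `d`, so it is above `b`.
  ...     | inj₁ d≤1̂ = inj₁ (≤-trans (join (b ∧ 1̂) (x∧y≤x b 1̂)
                         (∨-least (∧-greatest a≤b a≤1̂) (∧-greatest 0̂≤b 0̂≤1̂))
                         (∧-greatest d≤b d≤1̂)) (x∧y≤y b 1̂))
  -- `a ∨ 0̂` is a common lower bound of itself and `d`, so it is below `a`.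
  ...     | inj₂ 0̂≤d = inj₂ (≤-trans (y≤x∨y a 0̂)
                         (meet (a ∨ 0̂) (x≤x∨y a 0̂) ≤-refl (∨-least a≤d 0̂≤d)))

  -- Boolean intervals of an expansion

  module Expansion {M : FinPoset c′ ℓ₁′ ℓ₂′} (E : IsExpansion K M) where
    open IsExpansion E
    private
      module M = FinPoset M

    -- Copy 0 is downward closed by `in₁≰in₀`, so nothing of copy 1 enters the interval.
    interval₀ : ∀ {a b p q} → interval finPoset a b ≅ interval M (in₀ a p) (in₀ b q)
    interval₀ {a} {b} {p} {q} = mk≅
      (λ (x , a≤x , x≤b) → in₀ x (≤-trans x≤b q) , in₀-mono a≤x , in₀-mono x≤b)
      in₀-mono in₀-cancel surjective
      where
      surjective : ∀ y → _
      surjective (y , a≤y , y≤b) with split y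
      ... | inj₁ (x , _ , y≈x) =
        (x , in₀-cancel (M.≤-trans a≤y (M.reflexive y≈x))
           , in₀-cancel (M.≤-trans (M.reflexive (M.Eq.sym y≈x)) y≤b))
        , M.antisym (M.≤-trans (in₀-mono ≤-refl) (M.reflexive (M.Eq.sym y≈x)))
                    (M.≤-trans (M.reflexive y≈x) (in₀-mono ≤-refl))
      ... | inj₂ (x , _ , y≈x) =
        contradiction (M.≤-trans (M.reflexive (M.Eq.sym y≈x)) y≤b) in₁≰in₀

    -- Dually, copy 1 is upward closed.
    interval₁ : ∀ {a b p q} → interval finPoset a b ≅ interval M (in₁ a p) (in₁ b q)
    interval₁ {a} {b} {p} {q} = mk≅
      (λ (x , a≤x , x≤b) → in₁ x (≤-trans p a≤x) , in₁-mono a≤x , in₁-mono x≤b)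
      in₁-mono in₁-cancel surjective
      where
      surjective : ∀ y → _
      surjective (y , a≤y , y≤b) with split y
      ... | inj₁ (x , _ , y≈x) =
        contradiction (M.≤-trans a≤y (M.reflexive y≈x)) in₁≰in₀
      ... | inj₂ (x , _ , y≈x) =
        (x , in₁-cancel (M.≤-trans a≤y (M.reflexive y≈x))
           , in₁-cancel (M.≤-trans (M.reflexive (M.Eq.sym y≈x)) y≤b))
        , M.antisym (M.≤-trans (in₁-mono ≤-refl) (M.reflexive (M.Eq.sym y≈x)))
                    (M.≤-trans (M.reflexive y≈x) (in₁-mono ≤-refl))

    -- The complements of (a ∨ 0̂ , 1) and of (b ∧ 1̂ , 0) force b ≤ 1̂ and 0̂ ≤ a.
    crossing-⊆K : ∀ {a b p q k} → interval M (in₀ a p) (in₁ b q) ≅ 𝐁 k → a ≤ b → 0̂ ≤ a × b ≤ 1̂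
    crossing-⊆K {a} {b} {p} {q} ψ a≤b = 0̂≤a , b≤1̂
      where
      u = in₁ (a ∨ 0̂) (y≤x∨y a 0̂)
      v = in₀ (b ∧ 1̂) (x∧y≤y b 1̂)

      b≤1̂ : b ≤ 1̂
      b≤1̂ with complement M ψ u (in₀₁-mono (x≤x∨y a 0̂)) (in₁-mono (∨-least a≤b q))
      ... | y , a≤y , y≤b , meet , join with split y
      -- A complement of `u` in copy 0 has `d ≤ b ∧ 1̂`; so `in₁ (b ∧ 1̂)` bounds `u` and `y` and
      -- must be above `in₁ b`.
      ...   | inj₁ (d , d≤1̂ , y≈d) = ≤-trans (in₁-cancel (join (in₁ (b ∧ 1̂) (∧-greatest q 0̂≤1̂))
                (in₁-mono (x∧y≤x b 1̂))
                (in₁-mono (∨-least (∧-greatest a≤b p) (∧-greatest q 0̂≤1̂)))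
                (M.≤-trans y≤d (in₀₁-mono (∧-greatest (in₀₁-cancel (M.≤-trans d≤y y≤b)) d≤1̂)))))
                (x∧y≤y b 1̂)
        where
        y≤d = M.reflexive y≈d
        d≤y = M.reflexive (M.Eq.sym y≈d)
      -- A complement in copy 1 would be above `u`, so the meet law would put `u` below `in₀ a`.
      ...   | inj₂ (d , 0̂≤d , y≈d) = contradiction
                (meet u (in₀₁-mono (x≤x∨y a 0̂)) M.≤-refl
                  (M.≤-trans (in₁-mono (∨-least (in₀₁-cancel (M.≤-trans a≤y y≤d)) 0̂≤d)) d≤y))
                in₁≰in₀
        where
        y≤d = M.reflexive y≈d
        d≤y = M.reflexive (M.Eq.sym y≈d)

      0̂≤a : 0̂ ≤ a
      0̂≤a with complement M ψ v (in₀-mono (∧-greatest a≤b p)) (in₀₁-mono (x∧y≤x b 1̂))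
      ... | y , a≤y , y≤b , meet , join with split y
      -- Dually, `in₀ (a ∨ 0̂)` is below both `v` and its complement, hence below `in₀ a`.
      ...   | inj₂ (d , 0̂≤d , y≈d) = ≤-trans (y≤x∨y a 0̂) (in₀-cancel (meet (in₀ (a ∨ 0̂) (∨-least p 0̂≤1̂))
                (in₀-mono (x≤x∨y a 0̂))
                (in₀-mono (∨-least (∧-greatest a≤b p) (∧-greatest q 0̂≤1̂)))
                (M.≤-trans (in₀₁-mono (∨-least (in₀₁-cancel (M.≤-trans a≤y y≤d)) 0̂≤d)) d≤y)))
        where
        y≤d = M.reflexive y≈d
        d≤y = M.reflexive (M.Eq.sym y≈d)
      ...   | inj₁ (d , d≤1̂ , y≈d) = contradiction
                (join v (in₀₁-mono (x∧y≤x b 1̂)) M.≤-refl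
                  (M.≤-trans y≤d (in₀-mono (∧-greatest (in₀₁-cancel (M.≤-trans d≤y y≤b)) d≤1̂))))
                in₁≰in₀
        where
        y≤d = M.reflexive y≈d
        d≤y = M.reflexive (M.Eq.sym y≈d)

    -- `in₁ a` covers `in₀ a`, since between them only the copy can change. Above this atom lies
    -- copy 1 of `[a , b]`, so `above-atom` lowers the rank by one.
    crossing-halve : ∀ {a b p q k} → interval M (in₀ a p) (in₁ b q) ≅ 𝐁 k → a ≤ b → 0̂ ≤ a →
                     ∃[ j ] k ≡ suc j × interval finPoset a b ≅ 𝐁 j
    crossing-halve {a} {b} {p} {q} ψ a≤b 0̂≤a =
      let (j , k≡1+j , χ) = above-atom M {w = in₁ a 0̂≤a} ψ (in₀₁-mono ≤-refl) (in₁-mono a≤b) in₁≰in₀ atom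
      in j , k≡1+j , ≅-trans interval₁ χ
      where
      atom : ∀ z → in₀ a p M.≤ z → z M.≤ in₁ a 0̂≤a → z M.≤ in₀ a p ⊎ in₁ a 0̂≤a M.≤ z
      atom z a≤z z≤a with split z
      ... | inj₁ (d , _ , z≈d) = inj₁ (M.≤-trans (M.reflexive z≈d)
              (in₀-mono (in₀₁-cancel (M.≤-trans (M.reflexive (M.Eq.sym z≈d)) z≤a))))
      ... | inj₂ (d , _ , z≈d) = inj₂ (M.≤-trans
              (in₁-mono (in₀₁-cancel (M.≤-trans a≤z (M.reflexive z≈d)))) (M.reflexive (M.Eq.sym z≈d)))

    -- The first coordinate of a subset selects the copy and the others a point of `[a , b]`;
    -- `0̂ ≤ a` and `b ≤ 1̂` place each such point in both copies.
    crossing-double : ∀ {a b p q k} → interval finPoset a b ≅ 𝐁 k → 0̂ ≤ a → b ≤ 1̂ →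
                      interval M (in₀ a p) (in₁ b q) ≅ 𝐁 (suc k)
    crossing-double {a} {b} {p} {q} {k} ψ 0̂≤a b≤1̂ = ≅-sym (mk≅ f f-mono f-cancel surjective)
      where
      module ψ = _≅_ ψ

      f : FS.Subset (suc k) → FinPoset.Carrier (interval M (in₀ a p) (in₁ b q))
      f (FS.outside ∷ U) = let (x , a≤x , x≤b) = from ψ U in
        in₀ x (≤-trans x≤b b≤1̂) , in₀-mono a≤x , in₀₁-mono x≤b
      f (FS.inside  ∷ U) = let (x , a≤x , x≤b) = from ψ U in
        in₁ x (≤-trans 0̂≤a a≤x) , in₀₁-mono a≤x , in₁-mono x≤b

      from-mono : ∀ {U V} → U FS.⊆ V → proj₁ (from ψ U) ≤ proj₁ (from ψ V)
      from-mono {U} {V} = _≅_.mono (≅-sym ψ) {U} {V}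

      from-cancel : ∀ {U V} → proj₁ (from ψ U) ≤ proj₁ (from ψ V) → U FS.⊆ V
      from-cancel {U} {V} = _≅_.cancel (≅-sym ψ) {U} {V}

      f-mono : ∀ {U V} → U FS.⊆ V → proj₁ (f U) M.≤ proj₁ (f V)
      f-mono {FS.outside ∷ _} {FS.outside ∷ _} U⊆V = in₀-mono (from-mono (FSₚ.drop-∷-⊆ U⊆V))
      f-mono {FS.outside ∷ _} {FS.inside  ∷ _} U⊆V = in₀₁-mono (from-mono (FSₚ.drop-∷-⊆ U⊆V))
      f-mono {FS.inside  ∷ _} {FS.inside  ∷ _} U⊆V = in₁-mono (from-mono (FSₚ.drop-∷-⊆ U⊆V))
      f-mono {FS.inside  ∷ _} {FS.outside ∷ _} U⊆V = case U⊆V here of λ ()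

      f-cancel : ∀ {U V} → proj₁ (f U) M.≤ proj₁ (f V) → U FS.⊆ V
      f-cancel {FS.outside ∷ _} {FS.outside ∷ _} le = FSₚ.out⊆ (from-cancel (in₀-cancel le))
      f-cancel {FS.outside ∷ _} {FS.inside  ∷ _} le = FSₚ.out⊆ (from-cancel (in₀₁-cancel le))
      f-cancel {FS.inside  ∷ _} {FS.inside  ∷ _} le = FSₚ.in⊆in (from-cancel (in₁-cancel le))
      f-cancel {FS.inside  ∷ _} {FS.outside ∷ _} le = contradiction le in₁≰in₀

      from-to : ∀ X → proj₁ (from ψ (ψ.to X)) L.≈ proj₁ X
      from-to X = ψ.injective (to-from ψ (ψ.to X))

      surjective : ∀ Y → ∃[ U ] proj₁ (f U) M.≈ proj₁ Y
      surjective (y , a≤y , y≤b) with split y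
      ... | inj₁ (x , _ , y≈x) =
        let X = x , in₀-cancel (M.≤-trans a≤y (M.reflexive y≈x))
                  , in₀₁-cancel (M.≤-trans (M.reflexive (M.Eq.sym y≈x)) y≤b)
        in (FS.outside ∷ ψ.to X)
         , M.antisym (M.≤-trans (in₀-mono (L.reflexive (from-to X))) (M.reflexive (M.Eq.sym y≈x)))
                     (M.≤-trans (M.reflexive y≈x) (in₀-mono (L.reflexive (L.Eq.sym (from-to X)))))
      ... | inj₂ (x , _ , y≈x) =
        let X = x , in₀₁-cancel (M.≤-trans a≤y (M.reflexive y≈x))
                  , in₁-cancel (M.≤-trans (M.reflexive (M.Eq.sym y≈x)) y≤b)
        in (FS.inside ∷ ψ.to X)
         , M.antisym (M.≤-trans (in₁-mono (L.reflexive (from-to X))) (M.reflexive (M.Eq.sym y≈x)))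
                     (M.≤-trans (M.reflexive y≈x) (in₁-mono (L.reflexive (L.Eq.sym (from-to X)))))

    -- Matching the Boolean intervals of the expansion

    infix 4 _∼₀_ _∼₁_
    _∼₀_ _∼₁_ : M.Carrier → L.Carrier → Set _
    x ∼₀ a = Σ (a ≤ 1̂) λ p → x M.≈ in₀ a p
    x ∼₁ a = Σ (0̂ ≤ a) λ p → x M.≈ in₁ a p

    private
      ∼₀-cong : ∀ {x y a b} → x M.≈ y → a L.≈ b → x ∼₀ a → y ∼₀ b
      ∼₀-cong x≈y a≈b (p , x≈a) = ≤-trans (L.reflexive (L.Eq.sym a≈b)) p ,
        M.Eq.trans (M.Eq.sym x≈y) (M.Eq.trans x≈a
          (M.antisym (in₀-mono (L.reflexive a≈b)) (in₀-mono (L.reflexive (L.Eq.sym a≈b)))))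

      ∼₁-cong : ∀ {x y a b} → x M.≈ y → a L.≈ b → x ∼₁ a → y ∼₁ b
      ∼₁-cong x≈y a≈b (p , x≈a) = ≤-trans p (L.reflexive a≈b) ,
        M.Eq.trans (M.Eq.sym x≈y) (M.Eq.trans x≈a
          (M.antisym (in₁-mono (L.reflexive a≈b)) (in₁-mono (L.reflexive (L.Eq.sym a≈b)))))

      ∼₀-injectiveˡ : ∀ {x y a} → x ∼₀ a → y ∼₀ a → x M.≈ y
      ∼₀-injectiveˡ (_ , x≈a) (_ , y≈a) =
        M.Eq.trans x≈a (M.Eq.trans (M.antisym (in₀-mono ≤-refl) (in₀-mono ≤-refl)) (M.Eq.sym y≈a))

      ∼₁-injectiveˡ : ∀ {x y a} → x ∼₁ a → y ∼₁ a → x M.≈ y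
      ∼₁-injectiveˡ (_ , x≈a) (_ , y≈a) =
        M.Eq.trans x≈a (M.Eq.trans (M.antisym (in₁-mono ≤-refl) (in₁-mono ≤-refl)) (M.Eq.sym y≈a))

      ∼₀-injectiveʳ : ∀ {x a b} → x ∼₀ a → x ∼₀ b → a L.≈ b
      ∼₀-injectiveʳ (_ , x≈a) (_ , x≈b) =
        L.antisym (in₀-cancel (M.reflexive (M.Eq.trans (M.Eq.sym x≈a) x≈b)))
                  (in₀-cancel (M.reflexive (M.Eq.trans (M.Eq.sym x≈b) x≈a)))

      ∼₁-injectiveʳ : ∀ {x a b} → x ∼₁ a → x ∼₁ b → a L.≈ b
      ∼₁-injectiveʳ (_ , x≈a) (_ , x≈b) =
        L.antisym (in₁-cancel (M.reflexive (M.Eq.trans (M.Eq.sym x≈a) x≈b)))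
                  (in₁-cancel (M.reflexive (M.Eq.trans (M.Eq.sym x≈b) x≈a)))

      ∼-disjoint : ∀ {x a b} → x ∼₀ a → ¬ x ∼₁ b
      ∼-disjoint (_ , x≈a) (_ , x≈b) =
        in₁≰in₀ (M.reflexive (M.Eq.trans (M.Eq.sym x≈b) x≈a))

    private
      M² L² K² : Setoid _ _
      M² = M.Eq.setoid ×ₛ M.Eq.setoid
      L² = L.Eq.setoid ×ₛ L.Eq.setoid
      K² = FinPoset.Eq.setoid ⟦ K ⟧ ×ₛ FinPoset.Eq.setoid ⟦ K ⟧

    -- The Boolean intervals of L that lie below 1̂ are sent to copy 0 and the
    -- others, which lie above 0̂, to copy 1; copy 1 of the intervals of K is
    -- then still available.
    data _↝_ : REL (Setoid.Carrier M²) (Setoid.Carrier ((L² ⊎ₛ K²) ⊎ₛ K²)) (c ⊔ ℓ₁ ⊔ ℓ₂ ⊔ c′ ⊔ ℓ₁′ ⊔ ℓ₂′) where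
      lower  : ∀ {x y a b} → x ∼₀ a → y ∼₀ b → (x , y) ↝ inj₁ (inj₁ (a , b))
      upper  : ∀ {x y a b} → ¬ b ≤ 1̂ → x ∼₁ a → y ∼₁ b → (x , y) ↝ inj₁ (inj₁ (a , b))
      upperK : ∀ {x y a b} → x ∼₁ proj₁ a → y ∼₁ proj₁ b → (x , y) ↝ inj₁ (inj₂ (a , b))
      cross  : ∀ {x y a b} → x ∼₀ proj₁ a → y ∼₁ proj₁ b → (x , y) ↝ inj₂ (a , b)

    private
      respˡ : ∀ {u v w} → Setoid._≈_ M² u v → u ↝ w → v ↝ w
      respˡ (e , f) (lower r s)   = lower (∼₀-cong e L.Eq.refl r) (∼₀-cong f L.Eq.refl s)
      respˡ (e , f) (upper n r s) = upper n (∼₁-cong e L.Eq.refl r) (∼₁-cong f L.Eq.refl s)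
      respˡ (e , f) (upperK r s)  = upperK (∼₁-cong e L.Eq.refl r) (∼₁-cong f L.Eq.refl s)
      respˡ (e , f) (cross r s)   = cross (∼₀-cong e L.Eq.refl r) (∼₁-cong f L.Eq.refl s)

      respʳ : ∀ {u v w} → Setoid._≈_ ((L² ⊎ₛ K²) ⊎ₛ K²) v w → u ↝ v → u ↝ w
      respʳ (inj₁ (inj₁ (e , f))) (lower r s)   = lower (∼₀-cong M.Eq.refl e r) (∼₀-cong M.Eq.refl f s)
      respʳ (inj₁ (inj₁ (e , f))) (upper n r s) = upper (λ le → n (≤-trans (L.reflexive f) le))
                                                    (∼₁-cong M.Eq.refl e r) (∼₁-cong M.Eq.refl f s)
      respʳ (inj₁ (inj₂ (e , f))) (upperK r s)  = upperK (∼₁-cong M.Eq.refl e r) (∼₁-cong M.Eq.refl f s)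
      respʳ (inj₂ (e , f))        (cross r s)   = cross (∼₀-cong M.Eq.refl e r) (∼₁-cong M.Eq.refl f s)

      injectiveˡ : ∀ {u v w} → u ↝ w → v ↝ w → Setoid._≈_ M² u v
      injectiveˡ (lower r s)         (lower r′ s′)       = ∼₀-injectiveˡ r r′ , ∼₀-injectiveˡ s s′
      -- The guard of `upper` prevents an interval of `L` from being reached from both copies.
      injectiveˡ (lower r (b≤1̂ , _)) (upper b≰1̂ _ _)    = contradiction b≤1̂ b≰1̂
      injectiveˡ (upper b≰1̂ _ _)     (lower _ (b≤1̂ , _)) = contradiction b≤1̂ b≰1̂
      injectiveˡ (upper _ r s)       (upper _ r′ s′)     = ∼₁-injectiveˡ r r′ , ∼₁-injectiveˡ s s′
      injectiveˡ (upperK r s)        (upperK r′ s′)      = ∼₁-injectiveˡ r r′ , ∼₁-injectiveˡ s s′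
      injectiveˡ (cross r s)         (cross r′ s′)       = ∼₀-injectiveˡ r r′ , ∼₁-injectiveˡ s s′

      -- Separates the two possible targets of an interval of copy 1: members of `K` are below `1̂`,
      -- which the guard of `upper` denies for `b`.
      upper≁upperK : ∀ {y b} {d : FinPoset.Carrier ⟦ K ⟧} → ¬ b ≤ 1̂ → y ∼₁ b → ¬ y ∼₁ proj₁ d
      upper≁upperK {d = _ , _ , d≤1̂} b≰1̂ s s′ = b≰1̂ (≤-trans (L.reflexive (∼₁-injectiveʳ s s′)) d≤1̂)

      injectiveʳ : ∀ {u v w} → u ↝ v → u ↝ w → Setoid._≈_ ((L² ⊎ₛ K²) ⊎ₛ K²) v w
      injectiveʳ (lower r s)   (lower r′ s′)   = inj₁ (inj₁ (∼₀-injectiveʳ r r′ , ∼₀-injectiveʳ s s′))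
      injectiveʳ (lower r _)   (upper _ r′ _)  = contradiction r′ (∼-disjoint r)
      injectiveʳ (lower r _)   (upperK r′ _)   = contradiction r′ (∼-disjoint r)
      injectiveʳ (lower _ s)   (cross _ s′)    = contradiction s′ (∼-disjoint s)
      injectiveʳ (upper _ r _) (lower r′ _)    = contradiction r (∼-disjoint r′)
      injectiveʳ (upper _ r s) (upper _ r′ s′) = inj₁ (inj₁ (∼₁-injectiveʳ r r′ , ∼₁-injectiveʳ s s′))
      injectiveʳ (upper n _ s) (upperK {b = d} _ s′) = contradiction s′ (upper≁upperK {d = d} n s)
      injectiveʳ (upper _ r _) (cross r′ _)    = contradiction r (∼-disjoint r′)
      injectiveʳ (upperK r _)  (lower r′ _)    = contradiction r (∼-disjoint r′)
      injectiveʳ (upperK {b = d} _ s) (upper n _ s′) = contradiction s (upper≁upperK {d = d} n s′)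
      injectiveʳ (upperK r s)  (upperK r′ s′)  = inj₁ (inj₂ (∼₁-injectiveʳ r r′ , ∼₁-injectiveʳ s s′))
      injectiveʳ (upperK r _)  (cross r′ _)    = contradiction r (∼-disjoint r′)
      injectiveʳ (cross _ s)   (lower _ s′)    = contradiction s (∼-disjoint s′)
      injectiveʳ (cross r _)   (upper _ r′ _)  = contradiction r′ (∼-disjoint r)
      injectiveʳ (cross r _)   (upperK r′ _)   = contradiction r′ (∼-disjoint r)
      injectiveʳ (cross r s)   (cross r′ s′)   = inj₂ (∼₀-injectiveʳ r r′ , ∼₁-injectiveʳ s s′)

      -- `K` is convex, so it contains everything between two of its elements.
      intervalK : ∀ (a b : FinPoset.Carrier ⟦ K ⟧) → interval ⟦ K ⟧ a b ≅ interval finPoset (proj₁ a) (proj₁ b)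
      intervalK (_ , 0̂≤a , _) (_ , _ , b≤1̂) = mk≅
        (λ ((x , _) , a≤x , x≤b) → x , a≤x , x≤b)
        id id
        (λ (x , a≤x , x≤b) → ((x , ≤-trans 0̂≤a a≤x , ≤-trans x≤b b≤1̂) , a≤x , x≤b) , L.Eq.refl)

    -- Rank `k - 1` without subtraction: the predicate is empty at `k = 0`, in accordance with `q`
    -- being 0 at negative ranks.
    BooleanIntervalOfPredecessor : ℕ → Pred (Setoid.Carrier K²) _
    BooleanIntervalOfPredecessor k u = ∃[ j ] k ≡ suc j × IsBooleanInterval ⟦ K ⟧ j u

    private
      Target : ℕ → Pred (Setoid.Carrier ((L² ⊎ₛ K²) ⊎ₛ K²)) _
      Target k = Sum-All.All (Sum-All.All (IsBooleanInterval finPoset k) (IsBooleanInterval ⟦ K ⟧ k))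
                             (BooleanIntervalOfPredecessor k)

      totalˡ : ∀ {k u} → IsBooleanInterval M k u → ∃[ v ] Target k v × u ↝ v
      totalˡ {k} {x , y} bool with split x | split y
      ... | inj₁ (a , p , x≈a) | inj₁ (b , p′ , y≈b) =
        let (a≤b , ψ) = IsBooleanInterval-resp M k (x≈a , y≈b) bool
        in _ , inj₁ (inj₁ (in₀-cancel a≤b , ≅-trans interval₀ ψ)) , lower (p , x≈a) (p′ , y≈b)
      ... | inj₁ (a , p , x≈a) | inj₂ (b , p′ , y≈b) =
        let (a≤b′ , ψ)    = IsBooleanInterval-resp M k (x≈a , y≈b) bool
            a≤b           = in₀₁-cancel a≤b′
            (0̂≤a , b≤1̂) = crossing-⊆K ψ a≤b
            (j , k≡ , χ)  = crossing-halve ψ a≤b 0̂≤a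
            A             = a , 0̂≤a , p
            B             = b , p′ , b≤1̂
        in inj₂ (A , B) , inj₂ (j , k≡ , a≤b , ≅-trans (intervalK A B) χ) , cross (p , x≈a) (p′ , y≈b)
      ... | inj₂ (a , p , x≈a) | inj₁ (b , p′ , y≈b) =
        contradiction (proj₁ (IsBooleanInterval-resp M k (x≈a , y≈b) bool)) in₁≰in₀
      -- Within copy 1 the test `b ≤ 1̂` decides whether the interval lies in `K`, as `0̂ ≤ a` is
      -- known.
      ... | inj₂ (a , p , x≈a) | inj₂ (b , p′ , y≈b)
        with IsBooleanInterval-resp M k (x≈a , y≈b) bool | b L.≤? 1̂
      ...   | a≤b′ , ψ | no b≰1̂  = _ , inj₁ (inj₁ (in₁-cancel a≤b′ , ≅-trans interval₁ ψ))
                                  , upper b≰1̂ (p , x≈a) (p′ , y≈b)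
      ...   | a≤b′ , ψ | yes b≤1̂ =
        let a≤b = in₁-cancel a≤b′
            A   = a , p , ≤-trans a≤b b≤1̂
            B   = b , p′ , b≤1̂
        in inj₁ (inj₂ (A , B))
        , inj₁ (inj₂ (a≤b , ≅-trans (intervalK A B) (≅-trans interval₁ ψ))) , upperK (p , x≈a) (p′ , y≈b)

      totalʳ : ∀ {k v} → Target k v → ∃[ u ] IsBooleanInterval M k u × u ↝ v
      totalʳ {v = inj₁ (inj₁ (a , b))} (inj₁ (inj₁ (a≤b , ψ)))
        -- Copy 0 is taken whenever it is available; otherwise the dichotomy gives `0̂ ≤ a`, which
        -- makes copy 1 available.
        with b L.≤? 1̂ | booleanInterval-dichotomy (a≤b , ψ)
      ... | yes b≤1̂ | _ = (in₀ a (≤-trans a≤b b≤1̂) , in₀ b b≤1̂)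
        , (in₀-mono a≤b , ≅-trans (≅-sym interval₀) ψ) , lower (_ , M.Eq.refl) (_ , M.Eq.refl)
      ... | no b≰1̂ | inj₁ b≤1̂ = contradiction b≤1̂ b≰1̂
      ... | no b≰1̂ | inj₂ 0̂≤a = (in₁ a 0̂≤a , in₁ b (≤-trans 0̂≤a a≤b))
        , (in₁-mono a≤b , ≅-trans (≅-sym interval₁) ψ) , upper b≰1̂ (_ , M.Eq.refl) (_ , M.Eq.refl)
      totalʳ {v = inj₁ (inj₂ (A@(a , 0̂≤a , _) , B@(b , 0̂≤b , _)))} (inj₁ (inj₂ (a≤b , ψ))) =
        (in₁ a 0̂≤a , in₁ b 0̂≤b)
        , (in₁-mono a≤b , ≅-trans (≅-sym interval₁) (≅-trans (≅-sym (intervalK A B)) ψ))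
        , upperK (_ , M.Eq.refl) (_ , M.Eq.refl)
      totalʳ {v = inj₂ (A@(a , 0̂≤a , a≤1̂) , B@(b , 0̂≤b , b≤1̂))} (inj₂ (j , refl , a≤b , ψ)) =
        (in₀ a a≤1̂ , in₁ b 0̂≤b)
        , (in₀₁-mono a≤b , crossing-double (≅-trans (≅-sym (intervalK A B)) ψ) 0̂≤a b≤1̂)
        , cross (_ , M.Eq.refl) (_ , M.Eq.refl)

      Counts-predecessor : ∀ k → Counts K² (BooleanIntervalOfPredecessor k) (q (+ k -ᶻ + 1) ⟦ K ⟧)
      -- `+ 0 -ᶻ + 1` reduces to a negative integer, where `q` is 0.
      Counts-predecessor zero    = Counts-∅ λ { (_ , () , _) }
      Counts-predecessor (suc k) =
        subst (λ i → Counts K² (BooleanIntervalOfPredecessor (suc k)) (q i ⟦ K ⟧)) k≡1+k-1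
          (Counts-resp (λ bool → k , refl , bool) (λ { (_ , refl , bool) → bool }) (Counts-q ⟦ K ⟧ k))
        where
        k≡1+k-1 : + k ≡ + suc k -ᶻ + 1
        k≡1+k-1 = refl

    q-expansion : ∀ k → q (+ k) M ≡ q (+ k) finPoset + q (+ k) ⟦ K ⟧ + q (+ k -ᶻ + 1) ⟦ K ⟧
    q-expansion k = Counts-≡ _↝_ respˡ respʳ injectiveˡ injectiveʳ totalˡ totalʳ
      (Counts-q M k) (Counts-⊎ (Counts-⊎ (Counts-q finPoset k) (Counts-q ⟦ K ⟧ k)) (Counts-predecessor k))

    card-expansion : card M ≡ card finPoset + card ⟦ K ⟧
    card-expansion = begin
      card M                                        ≡⟨ q₀≡card M ⟨
      -- At `k = 0` the last summand of `q-expansion` reduces to 0.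
      q (+ 0) M                                     ≡⟨ q-expansion 0 ⟩
      q (+ 0) finPoset + q (+ 0) ⟦ K ⟧ + 0          ≡⟨ ℕ.+-identityʳ _ ⟩
      q (+ 0) finPoset + q (+ 0) ⟦ K ⟧              ≡⟨ ≡.cong₂ _+_ (q₀≡card finPoset) (q₀≡card ⟦ K ⟧) ⟩
      card finPoset + card ⟦ K ⟧                    ∎
      where open ≡-Reasoning

-- Filters of P_K

module _ (M : Poset c ℓ₁ ℓ₂) (_≤?_ : ∀ x y → Dec (Poset._≤_ M x y)) where
  open Poset M hiding (trans) renaming (refl to ≤-refl)

  -- One pass moves up at each larger element of `Q`. An element passed over is not a larger one in
  -- `Q`, and later moves upward preserve this.
  maximal-above : {Q : Pred Carrier p} → Decidable Q → ∀ xs {x} → Q x →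
                  ∃[ m ] Q m × x ≤ m × All (λ y → Q y → m ≤ y → m ≈ y) xs
  maximal-above Q? []       {x} qx = x , qx , ≤-refl , []
  maximal-above Q? (y ∷ ys) {x} qx with Q? y ×-dec (x ≤? y)
  ... | yes (qy , x≤y) = let (m , qm , y≤m , max) = maximal-above Q? ys qy in
    m , qm , Poset.trans M x≤y y≤m , (λ _ m≤y → antisym m≤y y≤m) ∷ max
  ... | no ¬above     = let (m , qm , x≤m , max) = maximal-above Q? ys qx in
    m , qm , x≤m , (λ qy m≤y → contradiction (qy , Poset.trans M x≤m m≤y) ¬above) ∷ max

module _ (P : FinPoset c ℓ₁ ℓ₂) (F₀ F₁ : Filter P) where
  open FinPoset P hiding (card)
  open Subset using (resp; contains)

  -- By finiteness, climbing outside `F₀` ends in `S₀`. Hence all elements outside `F₀` are below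
  -- the new element.
  below-S₀ : ∀ {z} → ¬ z ∈ proj₁ F₀ → ∃[ s ] S₀ P F₀ F₁ s × z ≤ s
  below-S₀ z∉ =
    let (m , m∉ , z≤m , max) =
          maximal-above poset _≤?_ (λ x → ¬? (T? (contains (proj₁ F₀) x))) elements z∉
    in m , (m∉ , λ y → All.lookupₛ Eq.setoid
      (λ y≈y′ h y′∉ m≤y′ → Eq.trans (h (y′∉ ∘ resp (proj₁ F₀) y≈y′)
                                       (≤-trans m≤y′ (reflexive (Eq.sym y≈y′)))) y≈y′)
      max (complete y)) , z≤m

  above-S₁ : ∀ {z} → z ∈ proj₁ F₁ → ∃[ s ] S₁ P F₀ F₁ s × s ≤ z
  above-S₁ z∈ =
    let (m , m∈ , m≤z , min) =
          -- Minimal elements are the maximal ones of the dual order.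
          maximal-above (Posetₚ.≥-poset poset) (λ x y → y ≤? x) (T? ∘ contains (proj₁ F₁)) elements z∈
    in m , (m∈ , λ y → All.lookupₛ Eq.setoid
      (λ y≈y′ h y′∈ y′≤m → Eq.trans (h (resp (proj₁ F₁) (Eq.sym y≈y′) y′∈)
                                       (≤-trans (reflexive y≈y′) y′≤m)) y≈y′)
      min (complete y)) , m≤z

module _ {L : FinDistributiveLattice c ℓ₁ ℓ₂} {P : FinPoset c′ ℓ₁′ ℓ₂′}
         (φ : FinDistributiveLattice.finPoset L ≅ 𝓕 P) (K : Cutting L) where
  open Cutting K
  private
    module L = FinPoset (FinDistributiveLattice.finPoset L)
    module P = FinPoset P
    module φ = _≅_ φ
    open Subset using (resp; contains)

    P⁺ : FinPoset _ _ _
    P⁺ = Defs.P_K {L = L} φ K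

    F₀ F₁ : Filter P
    F₀ = φ.to 0̂
    F₁ = φ.to 1̂

    with-xK : (V : Filter P) → proj₁ F₁ ⊆ proj₁ V → Filter P⁺
    with-xK (V , V-up) F₁⊆V = record
      { contains = λ { nothing → true ; (just z) → contains V z }
      ; resp     = λ { (just x≈y) → resp V x≈y ; nothing → id } }
      , λ { _ _ (old x≤y) → V-up _ _ x≤y
          ; _ _ (below _) → λ _ → _
          -- Elements above the new one are above some `s` in `F₁`, which `V` contains.
          ; _ _ (above (s , (s∈F₁ , _) , s≤y)) → λ _ → V-up s _ s≤y (F₁⊆V s∈F₁)
          ; _ _ new → id }

    without-xK : (V : Filter P) → proj₁ V ⊆ proj₁ F₀ → Filter P⁺
    without-xK (V , V-up) V⊆F₀ = record
      { contains = λ { nothing → false ; (just z) → contains V z }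
      ; resp     = λ { (just x≈y) → resp V x≈y ; nothing → id } }
      , λ { _ _ (old x≤y) → V-up _ _ x≤y
          -- A member of `V` below the new element would force some `s` of `S₀` into `F₀`.
          ; _ _ (below (s , (s∉F₀ , _) , z≤s)) z∈V → s∉F₀ (proj₂ F₀ _ s z≤s (V⊆F₀ z∈V))
          ; _ _ (above _) ()
          ; _ _ new → id }

    restrict : Filter P⁺ → Filter P
    restrict (G , G-up) = record { contains = contains G ∘ just ; resp = resp G ∘ just }
      , λ x y x≤y → G-up (just x) (just y) (old x≤y)

    F₁⊆restrict : (G : Filter P⁺) → T (contains (proj₁ G) nothing) → proj₁ F₁ ⊆ proj₁ (restrict G)
    F₁⊆restrict (_ , G-up) xK∈G y∈F₁ = G-up nothing _ (above (above-S₁ P F₀ F₁ y∈F₁)) xK∈G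

    -- An element of `G` outside `F₀` would lie below the new element and force it into `G`.
    restrict⊆F₀ : (G : Filter P⁺) → ¬ T (contains (proj₁ G) nothing) → proj₁ (restrict G) ⊆ proj₁ F₀
    restrict⊆F₀ (_ , G-up) xK∉G {z} z∈G = decidable-stable (T? (contains (proj₁ F₀) z)) λ z∉F₀ →
      xK∉G (G-up (just z) nothing (below (below-S₀ P F₀ F₁ z∉F₀)) z∈G)

    module M = FinPoset (𝓕 P⁺)

    -- Under reverse inclusion, adding the new element moves a filter down, so copy 0 is the one
    -- that contains it.
    into₀ : ∀ a → a L.≤ 1̂ → Filter P⁺
    into₀ a a≤1̂ = with-xK (φ.to a) (φ.mono a≤1̂)

    into₁ : ∀ a → 0̂ L.≤ a → Filter P⁺
    into₁ a 0̂≤a = without-xK (φ.to a) (φ.mono 0̂≤a)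

    split : ∀ G → (∃[ a ] Σ (a L.≤ 1̂) λ p → G M.≈ into₀ a p) ⊎ (∃[ a ] Σ (0̂ L.≤ a) λ p → G M.≈ into₁ a p)
    split G with from φ (restrict G) | to-from φ (restrict G) | T? (contains (proj₁ G) nothing)
    ... | a | V⊆φa , φa⊆V | yes xK∈G = inj₁ (a , φ.cancel (λ y∈ → V⊆φa (F₁⊆restrict G xK∈G y∈))
          , (λ { {just _} → φa⊆V ; {nothing} _ → xK∈G }) , (λ { {just _} → V⊆φa ; {nothing} _ → _ }))
    ... | a | V⊆φa , φa⊆V | no xK∉G = inj₂ (a , φ.cancel (λ z∈ → restrict⊆F₀ G xK∉G (φa⊆V z∈))
          , (λ { {just _} → φa⊆V ; {nothing} () }) , (λ { {just _} → V⊆φa ; {nothing} → xK∉G }))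

  ⊞-isExpansion : IsExpansion K (L ⊞[ φ ] K)
  ⊞-isExpansion = record
    { in₀         = into₀
    ; in₁         = into₁
    ; in₀-mono    = λ a≤b → λ { {just _} → φ.mono a≤b ; {nothing} → id }
    ; in₀-cancel  = λ le → φ.cancel λ {x} → le {just x}
    ; in₁-mono    = λ a≤b → λ { {just _} → φ.mono a≤b ; {nothing} → id }
    ; in₁-cancel  = λ le → φ.cancel λ {x} → le {just x}
    ; in₀₁-mono   = λ a≤b → λ { {just _} → φ.mono a≤b ; {nothing} _ → _ }
    ; in₀₁-cancel = λ le → φ.cancel λ {x} → le {just x}
    -- The inclusion fails at the new element, which only the filter of copy 0 contains.
    ; in₁≰in₀     = λ le → le {nothing} _
    ; split       = split
    }

theorem4 : ∀ {c ℓ₁ ℓ₂ c′ ℓ₁′ ℓ₂′} (L : FinDistributiveLattice c ℓ₁ ℓ₂) (P : FinPoset c′ ℓ₁′ ℓ₂′) →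
    let open FinDistributiveLattice L using (finPoset) in
    (φ : finPoset ≅ 𝓕 P) (K : Cutting L) →
    ((k : ℕ) → q (+ k) (L ⊞[ φ ] K) ≡ q (+ k) finPoset + q (+ k) ⟦ K ⟧ + q (+ k -ᶻ + 1) ⟦ K ⟧)
    × card (L ⊞[ φ ] K) ≡ card finPoset + card ⟦ K ⟧
theorem4 L P φ K = q-expansion , card-expansion
  where open Expansion K (⊞-isExpansion φ K)
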